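{- Every subcubic graph $G$ with $\mathrm{mad}(G) < \frac{12}{5}$ has a good coloring, i.e., a $(1,2^5)$-packing edge-coloring with colors $1,2_1,2_2,2_3,2_4,2_5$ such that for each vertex $u$ of degree exactly $2$ in $G$, if $u$ sees the color $1$, then $u$ does not see all five of the colors $2_1,2_2,2_3,2_4,2_5$.
   Context: Graphs are finite and simple. A graph is subcubic if its maximum degree is at most $3$. $\mathrm{mad}(G)$ denotes the maximum average degree, i.e., the maximum of $2|E(H)|/|V(H)|$ over all nonempty subgraphs $H$ of $G$. For distinct edges $e,f$ of $G$, the distance between $e$ and $f$ is the distance between the corresponding vertices of the line graph $L(G)$ (so edges sharing an endpoint are at distance $1$). A $(1,2^5)$-packing edge-coloring of $G$ is a partition of $E(G)$ into six classes (possibly empty), labelled by the colors $1,2_1,2_2,2_3,2_4,2_5$, such that any two distinct edges of color $1$ are at distance at least $2$ (color $1$ is a matching), and for each $i$ any two distinct edges of color $2_i$ are at distance at least $3$ (color $2_i$ is an induced matching). A vertex $u$ sees the color $1$ if some edge incident with $u$ has color $1$. A vertex $u$ sees the color $2_i$ if there is an edge $u_1u_2$ of color $2_i$ such that $u_1$ or $u_2$ is at distance at most one from $u$ in $G$. -}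

module Defs where

open import Data.Empty using (⊥-elim-irr)
open import Data.Fin using (Fin; _<_)
open import Data.Fin.Properties using (_≟_; all?)
open import Data.Fin.Subset using (Subset; inside; outside; _∈_; ∣_∣; ⊤; ⊥)
open import Data.Fin.Subset.Properties using (_∈?_; ∈⊤; ∣⊤∣≡n; ∣⊥∣≡0)
open import Data.Integer using (+_)
open import Data.List using (List; []; _∷_; map; mapMaybe; cartesianProduct; cartesianProductWith; tabulate)
open import Data.List.Extrema.Nat using () renaming (max to maxℕ)
open import Data.List.Membership.Propositional using () renaming (_∈_ to _∈ˡ_)
open import Data.List.Membership.Propositional.Properties using (∈-cartesianProduct⁺; ∈-cartesianProductWith⁺; ∈-map⁺; ∈-map⁻)
open import Data.List.Relation.Unary.All using (lookup)
open import Data.List.Relation.Unary.Any using (here; there)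
import Data.List.Relation.Unary.Any as Any
import Data.List.Relation.Unary.Any.Properties as Any
open import Data.Maybe using (Maybe; just; nothing)
import Data.Maybe.Relation.Unary.Any as Maybe
open import Data.Nat using (ℕ; zero; suc; NonZero; _*_; _≤_)
open import Data.Nat.Properties using (nonZero?)
open import Data.Product using (∃-syntax; _×_; _,_)
open import Data.Rational using (ℚ; 0ℚ; _/_) renaming (_≤_ to _≤ℚ_)
open import Data.Rational.Properties using (≤-decTotalOrder; 0/n≡0; /-cong)
open import Data.Sum using (_⊎_; inj₁; inj₂)
import Data.Vec as Vec
open import Level using (0ℓ)
open import Relation.Binary using (Rel; DecTotalOrder)
import Data.List.Extrema (DecTotalOrder.totalOrder ≤-decTotalOrder) as ℚMax
open import Relation.Binary.PropositionalEquality using (_≡_; _≢_; refl; sym; trans; cong; subst)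
open import Relation.Nullary using (¬_; Dec; yes; no; does)
open import Relation.Nullary.Decidable using (_×-dec_; _⊎-dec_; _→-dec_)

-- A finite simple graph with vertex set Fin order and edge set Fin size.
-- The unordered pair of ends of an edge is stored in increasing order, so
-- src<tgt excludes loops and ends-injective excludes parallel edges; the
-- order carries no orientation.
record Graph : Set where
  field
    order : ℕ
    size  : ℕ

  Vertex : Set
  Vertex = Fin order

  Edge : Set
  Edge = Fin size

  field
    src tgt        : Edge → Vertex
    src<tgt        : ∀ e → src e < tgt e
    ends-injective : ∀ {e f} → src e ≡ src f → tgt e ≡ tgt f → e ≡ f

  Incident : Vertex → Edge → Set
  Incident u e = u ≡ src e ⊎ u ≡ tgt e

  incident? : ∀ u e → Dec (Incident u e)
  incident? u e = (u ≟ src e) ⊎-dec (u ≟ tgt e)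

  Adjacent : Rel Vertex 0ℓ
  Adjacent u v = ∃[ e ] ((u ≡ src e × v ≡ tgt e) ⊎ (u ≡ tgt e × v ≡ src e))

  incidentEdges : Vertex → Subset size
  incidentEdges u = Vec.tabulate (λ e → does (incident? u e))

  degree : Vertex → ℕ
  degree u = ∣ incidentEdges u ∣

  maxDegree : ℕ
  maxDegree = maxℕ 0 (tabulate degree)

  Subcubic : Set
  Subcubic = maxDegree ≤ 3

  -- Adjacency in the line graph.
  LineAdjacent : Rel Edge 0ℓ
  LineAdjacent e f = e ≢ f × ∃[ v ] (Incident v e × Incident v f)

data Walk {A : Set} (R : Rel A 0ℓ) : ℕ → A → A → Set where
  []  : ∀ {x} → Walk R 0 x x
  _∷_ : ∀ {k x y z} → R x y → Walk R k y z → Walk R (suc k) x z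

-- The distance is the least length of a walk, and infinite if there is none.
Distance≤ : {A : Set} → Rel A 0ℓ → ℕ → Rel A 0ℓ
Distance≤ R k x y = ∃[ l ] (l ≤ k × Walk R l x y)

Distance≥ : {A : Set} → Rel A 0ℓ → ℕ → Rel A 0ℓ
Distance≥ R k x y = ∀ {l} → Walk R l x y → k ≤ l

module _ (G : Graph) where
  open Graph G

  Closed : Subset order → Subset size → Set
  Closed vs es = ∀ e → e ∈ es → src e ∈ vs × tgt e ∈ vs

  closed? : ∀ vs es → Dec (Closed vs es)
  closed? vs es =
    all? λ e → (e ∈? es) →-dec ((src e ∈? vs) ×-dec (tgt e ∈? vs))

  -- Nonempty, and not necessarily induced.
  record Subgraph : Set where
    constructor subgraph
    field
      vertices     : Subset order
      edges        : Subset size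
      .closed      : Closed vertices edges
      .{{nonempty}} : NonZero ∣ vertices ∣

  averageDegree : Subgraph → ℚ
  averageDegree (subgraph vs es _) = + (2 * ∣ es ∣) / ∣ vs ∣

  subgraph? : Subset order × Subset size → Maybe Subgraph
  subgraph? (vs , es) with closed? vs es | nonZero? ∣ vs ∣
  ... | yes c | yes nz = just (subgraph vs es c {{nz}})
  ... | _     | _      = nothing

allSubsets : ∀ n → List (Subset n)
allSubsets zero    = Vec.[] ∷ []
allSubsets (suc n) =
  cartesianProductWith Vec._∷_ (inside ∷ outside ∷ []) (allSubsets n)

subgraphs : (G : Graph) → List (Subgraph G)
subgraphs G =
  mapMaybe (subgraph? G) (cartesianProduct (allSubsets order) (allSubsets size))
  where open Graph G

-- The base value 0 of the maximum only matters for the graph with no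
-- vertices, which has no nonempty subgraph; see mad-attained.
mad : Graph → ℚ
mad G = ℚMax.max 0ℚ (map (averageDegree G) (subgraphs G))

∈-allSubsets : ∀ {n} (p : Subset n) → p ∈ˡ allSubsets n
∈-allSubsets Vec.[]      = here refl
∈-allSubsets (s Vec.∷ p) = ∈-cartesianProductWith⁺ Vec._∷_ (side s) (∈-allSubsets p)
  where
  side : ∀ s → s ∈ˡ inside ∷ outside ∷ []
  side inside  = here refl
  side outside = there (here refl)

∈-subgraphs : ∀ G (H : Subgraph G) → H ∈ˡ subgraphs G
∈-subgraphs G H@(subgraph vs es c {{nz}}) =
  Any.mapMaybe⁺ (subgraph? G) _ (Any.map⁺ (Any.map found
    (∈-cartesianProduct⁺ (∈-allSubsets vs) (∈-allSubsets es))))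
  where
  found : ∀ {p} → (vs , es) ≡ p → Maybe.Any (H ≡_) (subgraph? G p)
  found refl with closed? G vs es | nonZero? ∣ vs ∣
  ... | yes _ | yes _  = Maybe.just refl
  ... | yes _ | no ¬nz = ⊥-elim-irr (¬nz nz)
  ... | no ¬c | _      = ⊥-elim-irr (¬c c)

averageDegree≤mad : ∀ G (H : Subgraph G) → averageDegree G H ≤ℚ mad G
averageDegree≤mad G H =
  lookup (ℚMax.xs≤max 0ℚ _) (∈-map⁺ (averageDegree G) (∈-subgraphs G H))

mad-attained : ∀ G → NonZero (Graph.order G) → ∃[ H ] averageDegree G H ≡ mad G
mad-attained G nz
  with ℚMax.argmax-sel (λ q → q) 0ℚ (map (averageDegree G) (subgraphs G))
... | inj₂ mad∈ with H , _ , mad≡ ← ∈-map⁻ (averageDegree G) mad∈ = H , sym mad≡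
... | inj₁ mad≡0 = edgeless , trans average≡0 (sym mad≡0)
  where
  open Graph G

  instance
    nonempty⊤ : NonZero ∣ ⊤ {order} ∣
    nonempty⊤ = subst NonZero (sym (∣⊤∣≡n order)) nz

  edgeless : Subgraph G
  edgeless = subgraph ⊤ ⊥ (λ _ _ → ∈⊤ , ∈⊤)

  average≡0 : averageDegree G edgeless ≡ 0ℚ
  average≡0 = trans
    (/-cong (cong (λ k → + (2 * k)) (∣⊥∣≡0 size)) refl)
    (0/n≡0 ∣ ⊤ {order} ∣)

data Color : Set where
  one : Color
  two : Fin 5 → Color

Coloring : Graph → Set
Coloring G = Graph.Edge G → Color

module _ (G : Graph) (c : Coloring G) where
  open Graph G

  IsPacking : Set
  IsPacking =
    (∀ e f → e ≢ f → c e ≡ one → c f ≡ one → Distance≥ LineAdjacent 2 e f) ×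
    (∀ i e f → e ≢ f → c e ≡ two i → c f ≡ two i → Distance≥ LineAdjacent 3 e f)

  Sees : Vertex → Color → Set
  Sees u one     = ∃[ e ] (Incident u e × c e ≡ one)
  Sees u (two i) = ∃[ e ] (c e ≡ two i ×
    (Distance≤ Adjacent 1 u (src e) ⊎ Distance≤ Adjacent 1 u (tgt e)))

  IsGood : Set
  IsGood = IsPacking ×
    (∀ u → degree u ≡ 2 → Sees u one → ¬ (∀ i → Sees u (two i)))

{-# OPTIONS --safe #-}

-- Induct on the number of edges, coloring the subgraphs (V, S) for S ⊆ E.  A
-- vertex w of degree at most 2 sees at most six edges, so it is bad, that is, it
-- violates the condition on vertices of degree 2, only if these edges show all six
-- colors once each; then both neighbors of w have degree 3 and no color occurs at
-- both of them.
--
-- A pendant edge uv can be added back: if v sees one and not the color i, color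
-- uv by i; if this makes the other end of the one-edge g at v bad, color g by i
-- and uv by one instead.  An edge uv between vertices of degree at most 2 can be
-- added back if its two neighboring edges do not share one of the colors two i.
-- To ensure this, the edge up next to uv is deleted as well and put back as a
-- pendant edge in a suitable color.  There is room for it if the other edges at
-- p lead to vertices of degree at most 2.  There is also room if one of them
-- leads to a vertex w of degree at most 2 that has a neighbor w' of degree at
-- most 2, for then ww' can be deleted too and added back last but one.
--
-- Without these configurations every non-isolated vertex charges at least 12 to
-- its edges, with every edge charged 10, so 10 |S| ≥ 12 |V(S)|, contrary to
-- mad < 12/5.

module Submission where

import Data.Nat.Properties
open import Defs
open import Algebra.Properties.CommutativeMonoid.Sum Data.Nat.Properties.+-0-commutativeMonoid
  using (∑-comm; ∑-distrib-+; sum-cong-≗; sum-replicate-zero) renaming (sum to ∑)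
open import Algebra.Properties.CommutativeSemigroup Data.Nat.Properties.+-commutativeSemigroup
  using (x∙yz≈y∙xz; x∙yz≈y∙zx)
open import Data.Bool using (Bool; true; false; if_then_else_)
open import Data.Empty using (⊥)
open import Data.Fin using (Fin; zero; suc)
open import Data.Fin.Properties using (_≟_; all?; any?; <⇒≢; injective⇒≤)
open import Data.Fin.Subset using (Subset; inside; outside; _∈_; _∉_; _⊆_; _─_; _-_; ∣_∣; ⁅_⁆; ⊤)
open import Data.Fin.Subset.Properties
  using (_∈?_; ∈⊤; nonempty?; p─q⊆p; p─x─y≡p─y─x; x∈⁅x⁆; x∈p∧x≢y⇒x∈p-y; x∈p⇒∣p-x∣<∣p∣)
open import Data.Integer using (+_)
import Data.Integer as ℤ
import Data.Integer.Properties as ℤ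
open import Data.List
  using (List; []; _∷_; _++_; map; filter; length; concatMap; allFin; tabulate; lookup)
open import Data.List.Extrema.Nat using (xs≤max)
open import Data.List.Membership.Propositional using (find; lose) renaming (_∈_ to _∈ˡ_)
open import Data.List.Membership.Propositional.Properties
  using (∈-++⁺ˡ; ∈-++⁺ʳ; ∈-++⁻; ∈-allFin; ∈-concatMap⁺; ∈-concatMap⁻; ∈-filter⁺; ∈-filter⁻;
         ∈-lookup; ∈-map⁺; ∈-tabulate⁺)
open import Data.List.Membership.Setoid.Properties using (index-injective)
open import Data.List.Properties using (filter-notAll; length-++; length-map)
open import Data.List.Relation.Unary.All as All using ([]; _∷_)
open import Data.List.Relation.Unary.AllPairs using ([]; _∷_)
open import Data.List.Relation.Unary.Any as Any using (Any; here; there)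
open import Data.List.Relation.Unary.Any.Properties using (++-comm; ++⁺ˡ; ++⁺ʳ)
open import Data.List.Relation.Unary.Unique.DecPropositional using (unique?)
open import Data.List.Relation.Unary.Unique.Propositional using (Unique)
open import Data.List.Relation.Unary.Unique.Propositional.Properties using (allFin⁺; filter⁺)
open import Data.Nat
  using (ℕ; zero; suc; _+_; _*_; _≤_; z≤n; s≤s; _≤?_; NonZero; >-nonZero) renaming (_<_ to _<ℕ_)
open import Data.Nat.ListAction using (sum)
open import Data.Nat.Properties
  using (*-assoc; *-comm; *-monoˡ-≤; *-suc; *-zeroʳ; +-assoc; +-comm; +-identityʳ; +-mono-≤;
         +-monoˡ-≤; <-irrefl; <-trans; <⇒≱; m≤m+n; m≤n+m; ≤-<-trans; ≤-pred; ≤-refl; ≤-reflexive;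
         ≤-trans; ≤⇒≯; ≰⇒>; module ≤-Reasoning)
open import Data.Product using (∃; ∃-syntax; _×_; _,_; proj₁; proj₂)
open import Data.Rational using (_/_; _<_)
import Data.Rational as ℚ
import Data.Rational.Properties as ℚ
open import Data.Rational.Unnormalised using (mkℚᵘ)
import Data.Rational.Unnormalised as ℚᵘ
import Data.Rational.Unnormalised.Properties as ℚᵘ
open import Data.Sum using (_⊎_; inj₁; inj₂; [_,_]′; map₂; swap)
import Data.Vec as Vec
open import Data.Vec using (here; there)
open import Data.Vec.Functional using (updateAt)
open import Data.Vec.Functional.Properties using (updateAt-minimal; updateAt-updates)
open import Data.Vec.Properties using (lookup∘tabulate; lookup⇒[]=; []=⇒lookup)
open import Function using (_∘_; const; id)
open import Relation.Binary using (DecidableEquality)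
open import Relation.Binary.PropositionalEquality
  using (_≡_; _≢_; refl; sym; trans; cong; cong₂; subst; subst₂; setoid; ≢-sym)
open import Relation.Nullary using (¬_; Dec; yes; no; contradiction; does; ¬?)
open import Relation.Nullary.Decidable
  using (_×-dec_; _⊎-dec_; _→-dec_; dec-true; dec-false; decidable-stable; from-yes; map′)

-- Membership in subsets, and a pigeonhole principle for lists.

x∈p─q⇒x∉q : ∀ {n} {x : Fin n} (p q : Subset n) → x ∈ p ─ q → x ∉ q
x∈p─q⇒x∉q (s Vec.∷ p) (inside Vec.∷ q) () here
x∈p─q⇒x∉q (s Vec.∷ p) (outside Vec.∷ q) (there x∈) (there x∈q) = x∈p─q⇒x∉q p q x∈ x∈q
x∈p─q⇒x∉q (s Vec.∷ p) (inside Vec.∷ q) (there x∈) (there x∈q) = x∈p─q⇒x∉q p q x∈ x∈q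

x∈p-y⇒x≢y : ∀ {n} {x : Fin n} (p : Subset n) y → x ∈ p - y → x ≢ y
x∈p-y⇒x≢y p y x∈ refl = x∈p─q⇒x∉q p ⁅ y ⁆ x∈ (x∈⁅x⁆ y)

module _ {A : Set} where

  -- Pigeonhole: sending a position in `xs` to the position of its entry in `ys` is injective
  -- because `xs` has no repetition.
  unique-⊆⇒length≤ : {xs ys : List A} → Unique xs → (∀ {x} → x ∈ˡ xs → x ∈ˡ ys) → length xs ≤ length ys
  unique-⊆⇒length≤ {[]}     []       sub = z≤n
  unique-⊆⇒length≤ {x ∷ xs} {ys} uniq sub = injective⇒≤ {f = λ i → Any.index (sub (∈-lookup i))}
    (λ {i} {j} eq → lookup-injective uniq i j
      (index-injective (setoid A) (sub (∈-lookup i)) (sub (∈-lookup j)) eq))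
    where
    lookup-injective : ∀ {xs : List A} → Unique xs → ∀ i j → lookup xs i ≡ lookup xs j → i ≡ j
    lookup-injective (_  ∷ _) zero    zero    _  = refl
    lookup-injective (x∉ ∷ _) zero    (suc j) eq = contradiction eq (All.lookup x∉ (∈-lookup j))
    lookup-injective (x∉ ∷ _) (suc i) zero    eq = contradiction (sym eq) (All.lookup x∉ (∈-lookup i))
    lookup-injective (_  ∷ u) (suc i) (suc j) eq = cong suc (lookup-injective u i j eq)

-- Colors, and lists of edges showing all six of them.

one≢two : ∀ {i} → one ≢ two i
one≢two ()

infix 4 _≟ᶜ_
_≟ᶜ_ : DecidableEquality Color
one   ≟ᶜ one   = yes refl
one   ≟ᶜ two j = no λ ()
two i ≟ᶜ one   = no λ ()
two i ≟ᶜ two j = map′ (cong two) (λ { refl → refl }) (i ≟ j)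

colors : List Color
colors = one ∷ map two (allFin 5)

Uses : ∀ {E : Set} → (E → Color) → List E → Color → Set
Uses c L k = Any (λ f → c f ≡ k) L

uses? : ∀ {E : Set} (c : E → Color) L k → Dec (Uses c L k)
uses? c L k = Any.any? (λ f → c f ≟ᶜ k) L

Rainbow : ∀ {E : Set} → (E → Color) → List E → Set
Rainbow c L = ∀ k → Uses c L k

infixl 5 _∖_
_∖_ : ∀ {n} → List (Fin n) → Fin n → List (Fin n)
L ∖ x = filter (λ y → ¬? (y ≟ x)) L

∈∖ : ∀ {n L} {x y : Fin n} → y ∈ˡ L → y ≢ x → y ∈ˡ L ∖ x
∈∖ = ∈-filter⁺ _

module _ {n} (c : Fin n → Color) where

  rainbow⇒6≤length : ∀ {L} → Rainbow c L → 6 ≤ length L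
  rainbow⇒6≤length {L} rb = subst (6 ≤_) (length-map c L)
    (unique-⊆⇒length≤ {xs = colors} (from-yes (unique? _≟ᶜ_ colors))
      λ {k} _ → let f , f∈ , eq = find (rb k) in subst (_∈ˡ map c L) eq (∈-map⁺ c f∈))

  -- Once `x` is dropped from `L`, its color is still shown by `y`, so six entries must remain. An
  -- edge lying in both `L` and `M` counts as a repetition too, with `y` equal to `x`.
  repeat⇒7≤length : ∀ {x y} L M → Rainbow c (L ++ M) →
    x ∈ˡ L → y ∈ˡ (L ∖ x) ++ M → c x ≡ c y → 7 ≤ length (L ++ M)
  repeat⇒7≤length {x} {y} L M rb x∈ y∈ cx≡cy = ≤-trans (s≤s (rainbow⇒6≤length rb′)) shorter
    where
    rb′ : Rainbow c ((L ∖ x) ++ M)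
    rb′ k with find (rb k)
    ... | f , f∈ , eq with f ≟ x | ∈-++⁻ L f∈
    ...   | yes refl | _         = lose y∈ (trans (sym cx≡cy) eq)
    ...   | no f≢x   | inj₁ f∈L = lose (∈-++⁺ˡ (∈∖ f∈L f≢x)) eq
    ...   | no f≢x   | inj₂ f∈M = lose (∈-++⁺ʳ _ f∈M) eq
    shorter : length ((L ∖ x) ++ M) <ℕ length (L ++ M)
    shorter rewrite length-++ (L ∖ x) {M} | length-++ L {M} =
      +-monoˡ-≤ (length M) (filter-notAll _ L (lose x∈ λ x≢x → x≢x refl))

-- Lengths of lists and finite sums.

length-filter-tabulate : ∀ {n} {A : Set} {P : A → Set} (P? : ∀ x → Dec (P x)) (f : Fin n → A) →
  length (filter P? (tabulate f)) ≡ ∣ Vec.tabulate (λ i → does (P? (f i))) ∣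
length-filter-tabulate {zero}  P? f = refl
length-filter-tabulate {suc n} P? f with does (P? (f zero))
... | true  = cong suc (length-filter-tabulate P? (f ∘ suc))
... | false = length-filter-tabulate P? (f ∘ suc)

module _ {A B : Set} (g : A → List B) where

  length-concatMap : ∀ {k} L → (∀ {x} → x ∈ˡ L → length (g x) ≤ k) → length (concatMap g L) ≤ length L * k
  length-concatMap []      g≤k = z≤n
  length-concatMap (x ∷ L) g≤k rewrite length-++ (g x) {concatMap g L} =
    +-mono-≤ (g≤k (here refl)) (length-concatMap L (g≤k ∘ there))

  length-concatMap-slack : ∀ {k d x} L → (∀ x → length (g x) ≤ k) →
    x ∈ˡ L → d + length (g x) ≤ k → d + length (concatMap g L) ≤ length L * k
  length-concatMap-slack {d = d} (x ∷ L) g≤k (here refl) slack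
    rewrite length-++ (g x) {concatMap g L} | sym (+-assoc d (length (g x)) (length (concatMap g L))) =
    +-mono-≤ slack (length-concatMap L (λ {y} _ → g≤k y))
  length-concatMap-slack {d = d} (y ∷ L) g≤k (there x∈L) slack
    rewrite length-++ (g y) {concatMap g L} | sym (+-assoc d (length (g y)) (length (concatMap g L)))
          | +-comm d (length (g y)) | +-assoc (length (g y)) d (length (concatMap g L)) =
    +-mono-≤ (g≤k y) (length-concatMap-slack L g≤k x∈L slack)

∑-mono : ∀ {n} {f g : Fin n → ℕ} → (∀ i → f i ≤ g i) → ∑ f ≤ ∑ g
∑-mono {zero}  f≤g = z≤n
∑-mono {suc n} f≤g = +-mono-≤ (f≤g zero) (∑-mono (f≤g ∘ suc))

∑-indicator : ∀ {n} (s : Fin n) x → ∑ (λ i → if does (i ≟ s) then x else 0) ≡ x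
∑-indicator {suc n} zero    x = trans (cong (λ t → x + t) (sum-replicate-zero n)) (+-identityʳ x)
∑-indicator {suc n} (suc s) x = ∑-indicator s x

∑-subset : ∀ {n} (p : Subset n) k → ∑ (λ i → if does (i ∈? p) then k else 0) ≡ k * ∣ p ∣
∑-subset Vec.[] k = sym (*-zeroʳ k)
∑-subset (inside  Vec.∷ p) k = trans (cong (λ t → k + t) (∑-subset p k)) (sym (*-suc k ∣ p ∣))
∑-subset (outside Vec.∷ p) k = ∑-subset p k

sum-filter-tabulate : ∀ {n} {A : Set} {P : A → Set} (P? : ∀ x → Dec (P x)) (g : A → ℕ) (f : Fin n → A) →
  sum (map g (filter P? (tabulate f))) ≡ ∑ (λ i → if does (P? (f i)) then g (f i) else 0)
sum-filter-tabulate {zero}  P? g f = refl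
sum-filter-tabulate {suc n} P? g f with does (P? (f zero))
... | true  = cong (λ t → g (f zero) + t) (sum-filter-tabulate P? g (f ∘ suc))
... | false = sum-filter-tabulate P? g (f ∘ suc)

if-no : ∀ {A : Set} (a? : Dec A) {x} → ¬ A → (if does a? then x else 0) ≤ 0
if-no (yes a) ¬a = contradiction a ¬a
if-no (no _)  _  = z≤n

-- Serves the double counting in `∑-total`, where a vertex contributes to an edge only as one of its
-- two ends.
if-either : ∀ {A P Q : Set} (a? : Dec A) (p? : Dec P) (q? : Dec Q) {x y z} →
  (A → (P × x ≤ y) ⊎ (Q × x ≤ z)) →
  (if does a? then x else 0) ≤ (if does p? then y else 0) + (if does q? then z else 0)
if-either (no _)  _  _  _ = z≤n
if-either (yes a) p? q? f with f a
... | inj₁ (p , x≤y) rewrite dec-true p? p = ≤-trans x≤y (m≤m+n _ _)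
... | inj₂ (q , x≤z) rewrite dec-true q? q = ≤-trans x≤z (m≤n+m _ _)

-- What the end v of an edge vw charges to it.  Low means of degree at most 2,
-- and paired means having a low neighbor.  The values are chosen such that the
-- two ends charge 10 together and a vertex charging less than 12 to its edges
-- lies in a reducible configuration.
share : (low-v low-w paired-v paired-w : Bool) → ℕ
share true  true  _ _ = 5
share true  false p _ = if p then 7 else 6
share false true  _ q = if q then 3 else 4
share false false _ _ = 5

share-sum : ∀ a b p q → share a b p q + share b a q p ≡ 10
share-sum true  true  _     _     = refl
share-sum true  false true  _     = refl
share-sum true  false false _     = refl
share-sum false true  _     true  = refl
share-sum false true  _     false = refl
share-sum false false _     _     = refl

-- Incidence, degrees and neighborhoods within a set of edges.

module Reducibility (G : Graph) (degree≤3 : ∀ v → Graph.degree G v ≤ 3) where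

  open Graph G

  EdgeSet : Set
  EdgeSet = Subset size

  Joins : Edge → Vertex → Vertex → Set
  Joins e u v = (u ≡ src e × v ≡ tgt e) ⊎ (u ≡ tgt e × v ≡ src e)

  other : Vertex → Edge → Vertex
  other u e = if does (u ≟ src e) then tgt e else src e

  module _ {e : Edge} where

    joins-sym : ∀ {u v} → Joins e u v → Joins e v u
    joins-sym (inj₁ (p , q)) = inj₂ (q , p)
    joins-sym (inj₂ (p , q)) = inj₁ (q , p)

    joinsˡ : ∀ {u v} → Joins e u v → Incident u e
    joinsˡ (inj₁ (p , _)) = inj₁ p
    joinsˡ (inj₂ (p , _)) = inj₂ p

    joinsʳ : ∀ {u v} → Joins e u v → Incident v e
    joinsʳ = joinsˡ ∘ joins-sym

    joins-≢ : ∀ {u v} → Joins e u v → u ≢ v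
    joins-≢ (inj₁ (refl , q)) u≡v = <⇒≢ (src<tgt e) (trans u≡v q)
    joins-≢ (inj₂ (refl , q)) u≡v = <⇒≢ (src<tgt e) (sym (trans u≡v q))

    joins-ends : ∀ {u v x} → Joins e u v → Incident x e → x ≡ u ⊎ x ≡ v
    joins-ends (inj₁ (refl , refl)) x∈e = x∈e
    joins-ends (inj₂ (refl , refl)) x∈e = swap x∈e

    joins-other : ∀ {u} → Incident u e → Joins e u (other u e)
    joins-other {u} u∈e with u ≟ src e | u∈e
    ... | yes p | _      = inj₁ (p , refl)
    ... | no ¬p | inj₁ p = contradiction p ¬p
    ... | no _  | inj₂ p = inj₂ (p , refl)

    other-joins : ∀ {u v} → Joins e u v → other u e ≡ v
    other-joins j with joins-ends (joins-other (joinsˡ j)) (joinsʳ j)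
    ... | inj₁ v≡u = contradiction (sym v≡u) (joins-≢ j)
    ... | inj₂ v≡o = sym v≡o

  -- Reflexive, unlike `LineAdjacent`, so that two meetings in a row cover the distances 1 and 2
  -- alike.
  Meets : Edge → Edge → Set
  Meets e f = ∃[ x ] (Incident x e × Incident x f)

  meets-sym : ∀ {e f} → Meets e f → Meets f e
  meets-sym (x , p , q) = x , q , p

  meets-refl : ∀ {e} → Meets e e
  meets-refl {e} = src e , inj₁ refl , inj₁ refl

  At : EdgeSet → Vertex → Edge → Set
  At S v e = e ∈ S × Incident v e

  at? : ∀ S v e → Dec (At S v e)
  at? S v e = (e ∈? S) ×-dec incident? v e

  star : EdgeSet → Vertex → List Edge
  star S v = filter (at? S v) (allFin size)

  deg : EdgeSet → Vertex → ℕ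
  deg S v = length (star S v)

  -- Repetitions are kept for the sake of counting: each edge at `u` contributes at most three
  -- entries. The edges at `u` itself are included, each lying in the star of its own far end.
  near : EdgeSet → Vertex → List Edge
  near S u = concatMap (λ h → star S (other u h)) (star S u)

  star⁺ : ∀ {S v e} → At S v e → e ∈ˡ star S v
  star⁺ {S} {v} {e} = ∈-filter⁺ (at? S v) (∈-allFin e)

  star⁻ : ∀ {S v e} → e ∈ˡ star S v → At S v e
  star⁻ {S} {v} = proj₂ ∘ ∈-filter⁻ (at? S v) {xs = allFin size}

  star-unique : ∀ S v → Unique (star S v)
  star-unique S v = filter⁺ (at? S v) (allFin⁺ size)

  deg≤degree : ∀ S v → deg S v ≤ degree v
  deg≤degree S v = ≤-trans (unique-⊆⇒length≤ (star-unique S v)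
      (λ e∈ → ∈-filter⁺ (incident? v) (∈-allFin _) (proj₂ (star⁻ {S} {v} e∈))))
    (≤-reflexive (length-filter-tabulate (incident? v) id))

  deg≤3 : ∀ S v → deg S v ≤ 3
  deg≤3 S v = ≤-trans (deg≤degree S v) (degree≤3 v)

  deg-mono : ∀ {S T} v → (∀ {e} → Incident v e → e ∈ T → e ∈ S) → deg T v ≤ deg S v
  deg-mono {S} {T} v T⊆S = unique-⊆⇒length≤ (star-unique T v)
    (λ e∈ → let e∈T , v∈e = star⁻ {T} {v} e∈ in star⁺ {S} (T⊆S v∈e e∈T , v∈e))

  ∈-remove⁻ : ∀ (S : EdgeSet) e {f} → f ∈ S - e → f ∈ S
  ∈-remove⁻ S e = p─q⊆p S ⁅ e ⁆

  ∈-remove⁺ : ∀ {S : EdgeSet} {e f} → f ∈ S → f ≢ e → f ∈ S - e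
  ∈-remove⁺ = x∈p∧x≢y⇒x∈p-y

  ∈-remove-≢ : ∀ (S : EdgeSet) e {f} → f ∈ S - e → f ≢ e
  ∈-remove-≢ S e = x∈p-y⇒x≢y S e

  deg-remove : ∀ {S v e} → At S v e → deg (S - e) v <ℕ deg S v
  deg-remove {S} {v} {e} (e∈S , v∈e) = unique-⊆⇒length≤
    (All.tabulate (λ f∈ → ≢-sym (∈-remove-≢ S e (proj₁ (star⁻ {S - e} {v} f∈)))) ∷ star-unique (S - e) v)
    λ { (here refl) → star⁺ {S} (e∈S , v∈e)
      ; (there f∈) → let f∈T , v∈f = star⁻ {S - e} {v} f∈ in star⁺ {S} (∈-remove⁻ S e f∈T , v∈f) }

  deg-remove≤ : ∀ S e v → deg (S - e) v ≤ deg S v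
  deg-remove≤ S e v = deg-mono {S} {S - e} v (λ _ → ∈-remove⁻ S e)

  only-edge : ∀ {S v e f} → deg S v ≤ 1 → At S v e → At S v f → f ≡ e
  only-edge {S} {v} {e} {f} d≤1 ate atf with f ≟ e
  ... | yes f≡e = f≡e
  ... | no  f≢e = contradiction (unique-⊆⇒length≤ ((f≢e ∷ []) ∷ [] ∷ [])
    λ { (here refl) → star⁺ {S} atf ; (there (here refl)) → star⁺ {S} ate }) (<⇒≱ (s≤s d≤1))

  two-edges : ∀ {S v e f g} → deg S v ≤ 2 → e ≢ f → At S v e → At S v f → At S v g → g ≡ e ⊎ g ≡ f
  two-edges {S} {v} {e} {f} {g} d≤2 e≢f ate atf atg with g ≟ e | g ≟ f
  ... | yes g≡e | _       = inj₁ g≡e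
  ... | no _    | yes g≡f = inj₂ g≡f
  ... | no g≢e  | no g≢f  = contradiction
    (unique-⊆⇒length≤ ((g≢e ∷ g≢f ∷ []) ∷ (e≢f ∷ []) ∷ [] ∷ [])
      λ { (here refl) → star⁺ {S} atg ; (there (here refl)) → star⁺ {S} ate
        ; (there (there (here refl))) → star⁺ {S} atf })
    (<⇒≱ (s≤s d≤2))

  near⁺ : ∀ {S u h f} → At S u h → f ∈ S → Meets h f → f ∈ˡ near S u
  near⁺ {S} {u} {h} {f} (h∈S , u∈h) f∈S (x , x∈h , x∈f) with joins-ends (joins-other u∈h) x∈h
  -- Here `h` and `f` meet at `u`, so `f` is found in the star of its own far end, not in that of
  -- `h`.
  ... | inj₁ refl = ∈-concatMap⁺ (λ h → star S (other u h))
    (lose (star⁺ {S} (f∈S , x∈f)) (star⁺ {S} (f∈S , joinsʳ (joins-other x∈f))))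
  ... | inj₂ refl = ∈-concatMap⁺ (λ h → star S (other u h))
    (lose (star⁺ {S} (h∈S , u∈h)) (star⁺ {S} (f∈S , x∈f)))

  near⁻ : ∀ {S u f} → f ∈ˡ near S u → ∃[ h ] (At S u h × At S (other u h) f)
  near⁻ {S} {u} f∈ with find (∈-concatMap⁻ (λ h → star S (other u h)) {star S u} f∈)
  ... | h , h∈ , f∈star = h , star⁻ {S} h∈ , star⁻ {S} f∈star

  star⊆near : ∀ {S u f} → At S u f → f ∈ˡ near S u
  star⊆near {S} at = near⁺ {S} at (proj₁ at) meets-refl

  length-near : ∀ {n} S u → deg S u ≤ n → length (near S u) ≤ n * 3
  length-near S u d≤n = ≤-trans
    (length-concatMap (λ h → star S (other u h)) (star S u) (λ {h} _ → deg≤3 S (other u h)))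
    (*-monoˡ-≤ 3 d≤n)

  length-near-slack : ∀ {n d h v} S u → deg S u ≤ n → h ∈ S → Joins h u v →
    d + deg S v ≤ 3 → d + length (near S u) ≤ n * 3
  length-near-slack {d = d} {h} S u d≤n h∈S j slack = ≤-trans
    (length-concatMap-slack (λ h → star S (other u h)) {d = d} (star S u) (λ h → deg≤3 S (other u h))
      (star⁺ {S} {u} (h∈S , joinsˡ j)) (subst (λ v → d + deg S v ≤ 3) (sym (other-joins j)) slack))
    (*-monoˡ-≤ 3 d≤n)

  -- Bad vertices and the counting of colors around them.

  Bad : EdgeSet → Coloring G → Vertex → Set
  Bad S c w = Uses c (star S w) one × (∀ i → Uses c (near S w) (two i))

  bad? : ∀ S c w → Dec (Bad S c w)
  bad? S c w = uses? c (star S w) one ×-dec all? (λ i → uses? c (near S w) (two i))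

  bad⇒rainbow : ∀ {S c w} → Bad S c w → Rainbow c (near S w)
  bad⇒rainbow {S} (one∈ , _) one with find one∈
  ... | f , f∈ , cf = lose (star⊆near {S} (star⁻ {S} f∈)) cf
  bad⇒rainbow (_ , twos) (two i) = twos i

  -- A single edge at `w` gives at most three entries of `near S w`, too few for six colors.
  bad⇒1<deg : ∀ {S c w} → Bad S c w → 1 <ℕ deg S w
  bad⇒1<deg {S} {c} {w} bad = ≰⇒> λ d≤1 →
    contradiction (≤-trans (rainbow⇒6≤length c (bad⇒rainbow {S} {c} {w} bad)) (length-near S w d≤1))
      λ { (s≤s (s≤s (s≤s ()))) }

  -- A neighbor of degree at most 2 would leave at most five entries for six colors.
  bad⇒2<deg-neighbor : ∀ {S c w h x} → deg S w ≤ 2 → Bad S c w → h ∈ S → Joins h w x → 2 <ℕ deg S x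
  bad⇒2<deg-neighbor {S} {c} {w} d≤2 bad h∈S j = ≰⇒> λ dx≤2 → <-irrefl refl
    (≤-trans (s≤s (rainbow⇒6≤length c (bad⇒rainbow {S} {c} {w} bad)))
             (length-near-slack S w d≤2 h∈S j (s≤s dx≤2)))

  -- The stars of the two neighbors of `w` have at most six entries together and show six colors, so
  -- no color repeats. This also rules out an edge common to both stars.
  bad⇒≢ : ∀ {S c w h h′ x x′ f f′} → deg S w ≤ 2 → Bad S c w → h ≢ h′ →
    h ∈ S → Joins h w x → h′ ∈ S → Joins h′ w x′ → At S x f → At S x′ f′ → c f ≢ c f′
  bad⇒≢ {S} {c} {w} {h} {h′} {x} {x′} {f} {f′} d≤2 bad h≢h′ h∈S j h′∈S j′ atf atf′ cf≡cf′ =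
    <-irrefl refl (≤-trans
      (repeat⇒7≤length c (star S x) (star S x′) rainbow (star⁺ {S} atf) (∈-++⁺ʳ _ (star⁺ {S} atf′)) cf≡cf′)
      (≤-trans (≤-reflexive (length-++ (star S x))) (+-mono-≤ (deg≤3 S x) (deg≤3 S x′))))
    where
    rainbow : Rainbow c (star S x ++ star S x′)
    rainbow k with find (bad⇒rainbow {S} {c} {w} bad k)
    ... | g , g∈ , eq with near⁻ {S} {w} g∈
    ... | h″ , ath″ , atg
        with two-edges {S} {w} d≤2 h≢h′ (h∈S , joinsˡ j) (h′∈S , joinsˡ j′) ath″
    ... | inj₁ refl rewrite other-joins j  = lose (∈-++⁺ˡ (star⁺ {S} atg)) eq
    ... | inj₂ refl rewrite other-joins j′ = lose (∈-++⁺ʳ _ (star⁺ {S} atg)) eq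

  -- Packings, fairness and the effect of adding one edge.

  record Packing (S : EdgeSet) (c : Coloring G) : Set where
    field
      matching : ∀ {e f} → e ∈ S → f ∈ S → Meets e f → c e ≡ one → c f ≡ one → e ≡ f
      induced  : ∀ {i e g f} → e ∈ S → g ∈ S → f ∈ S → Meets e g → Meets g f →
                 c e ≡ two i → c f ≡ two i → e ≡ f

  open Packing public

  -- Vertices of degree less than 2 are never bad (bad⇒1<deg); including them makes
  -- the hypothesis on w pass from S to its subsets.
  Fair : EdgeSet → Coloring G → Set
  Fair S c = ∀ w → deg S w ≤ 2 → ¬ Bad S c w

  Good : EdgeSet → Coloring G → Set
  Good S c = Packing S c × Fair S c

  packing-mono : ∀ {S T c} → T ⊆ S → Packing S c → Packing T c
  packing-mono T⊆S p .matching e∈ f∈ = matching p (T⊆S e∈) (T⊆S f∈)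
  packing-mono T⊆S p .induced e∈ g∈ f∈ = induced p (T⊆S e∈) (T⊆S g∈) (T⊆S f∈)

  infix 9 _[_≔_]
  _[_≔_] : Coloring G → Edge → Color → Coloring G
  c [ e ≔ k ] = updateAt c e (const k)

  ≔-same : ∀ c e {k} → (c [ e ≔ k ]) e ≡ k
  ≔-same c e = updateAt-updates e c

  ≔-other : ∀ c {e f k} → f ≢ e → (c [ e ≔ k ]) f ≡ c f
  ≔-other c {e} {f} = updateAt-minimal f e c

  -- Adding e to T brings no two edges with a common color two i within distance 2.
  Separates : Edge → EdgeSet → Coloring G → Set
  Separates e T c = ∀ {i f g} → f ∈ T → g ∈ T → Meets f e → Meets e g → c f ≡ two i → c g ≡ two i → f ≡ g

  split : ∀ {S : EdgeSet} e {f} → f ∈ S → f ≡ e ⊎ (f ≢ e × f ∈ S - e)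
  split e {f} f∈S with f ≟ e
  ... | yes f≡e = inj₁ f≡e
  ... | no  f≢e = inj₂ (f≢e , ∈-remove⁺ f∈S f≢e)

  -- A new conflict involves `e` itself or two old edges brought together by `e`. Recoloring is a
  -- case of this: the edge is first dropped by `packing-mono` and then added in its new color.
  extend : ∀ {S c e k} → Packing (S - e) c → Separates e (S - e) c →
    (∀ {f} → k ≡ one → f ∈ S - e → Meets e f → c f ≢ one) →
    (∀ {i f g} → k ≡ two i → f ∈ S - e → g ∈ S → Meets e g → Meets g f → c f ≢ two i) →
    Packing S (c [ e ≔ k ])
  extend {S} {c} {e} {k} p sep one-free two-free = record { matching = m ; induced = ind }
    where
    c′ = c [ e ≔ k ]
    m : ∀ {f g} → f ∈ S → g ∈ S → Meets f g → c′ f ≡ one → c′ g ≡ one → f ≡ g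
    m f∈ g∈ fg c′f c′g with split e f∈ | split e g∈
    ... | inj₁ refl | inj₁ refl = refl
    ... | inj₁ refl | inj₂ (g≢ , g∈T) =
      contradiction (trans (sym (≔-other c g≢)) c′g) (one-free (trans (sym (≔-same c e)) c′f) g∈T fg)
    ... | inj₂ (f≢ , f∈T) | inj₁ refl =
      contradiction (trans (sym (≔-other c f≢)) c′f) (one-free (trans (sym (≔-same c e)) c′g) f∈T (meets-sym fg))
    ... | inj₂ (f≢ , f∈T) | inj₂ (g≢ , g∈T) =
      matching p f∈T g∈T fg (trans (sym (≔-other c f≢)) c′f) (trans (sym (≔-other c g≢)) c′g)
    ind : ∀ {i f h g} → f ∈ S → h ∈ S → g ∈ S → Meets f h → Meets h g → c′ f ≡ two i → c′ g ≡ two i → f ≡ g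
    ind f∈ h∈ g∈ fh hg c′f c′g with split e f∈ | split e g∈
    ... | inj₁ refl | inj₁ refl = refl
    ... | inj₁ refl | inj₂ (g≢ , g∈T) =
      contradiction (trans (sym (≔-other c g≢)) c′g) (two-free (trans (sym (≔-same c e)) c′f) g∈T h∈ fh hg)
    ... | inj₂ (f≢ , f∈T) | inj₁ refl =
      contradiction (trans (sym (≔-other c f≢)) c′f)
        (two-free (trans (sym (≔-same c e)) c′g) f∈T h∈ (meets-sym hg) (meets-sym fh))
    ... | inj₂ (f≢ , f∈T) | inj₂ (g≢ , g∈T) with split e h∈
    ...   | inj₁ refl = sep f∈T g∈T fh hg (trans (sym (≔-other c f≢)) c′f) (trans (sym (≔-other c g≢)) c′g)
    ...   | inj₂ (_ , h∈T) =
      induced p f∈T h∈T g∈T fh hg (trans (sym (≔-other c f≢)) c′f) (trans (sym (≔-other c g≢)) c′g)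

  joins : ∀ {e u v} → Incident u e → Incident v e → u ≢ v → Joins e u v
  joins u∈e v∈e u≢v with joins-ends (joins-other u∈e) v∈e
  ... | inj₁ refl = contradiction refl u≢v
  ... | inj₂ refl = joins-other u∈e

  bad⇒2<deg-end : ∀ {S c w h x} → deg S w ≤ 2 → Bad S c w → At S w h → Incident x h → w ≢ x → 2 <ℕ deg S x
  bad⇒2<deg-end {S} {c} d≤2 bad (h∈S , w∈h) x∈h w≢x =
    bad⇒2<deg-neighbor {S} {c} d≤2 bad h∈S (joins w∈h x∈h w≢x)

  bad-edge : ∀ {S c w} → Bad S c w → ∃[ h ] (At S w h × c h ≡ one)
  bad-edge {S} (one∈ , _) with find one∈
  ... | h , h∈ , eq = h , star⁻ {S} h∈ , eq

  -- If `w` were bad now, it would have been bad before. Edges not at `w` matter only if they now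
  -- have a color `two i`; one that has turned to `one` does not help to make `w` bad.
  fair-transfer : ∀ {S T c c′ w} → T ⊆ S → Fair T c → deg S w ≤ 2 →
    (∀ {h} → At S w h → h ∈ T × c′ h ≡ c h) →
    (∀ {i h f} → At S w h → f ∈ S → Meets h f → c′ f ≡ two i → f ∈ T × c′ f ≡ c f) →
    ¬ Bad S c′ w
  fair-transfer {S} {T} {c} {c′} {w} T⊆S fair d≤2 same-at same-near bad@(_ , twos) =
    fair w (≤-trans (deg-mono {S} {T} w (λ _ → T⊆S)) d≤2) (one∈ , two∈)
    where
    one∈ : Uses c (star T w) one
    one∈ with bad-edge {S} {c′} {w} bad
    ... | h , ath , c′h with same-at ath
    ... | h∈T , eq = lose (star⁺ {T} (h∈T , proj₂ ath)) (trans (sym eq) c′h)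
    two∈ : ∀ i → Uses c (near T w) (two i)
    two∈ i with find (twos i)
    ... | f , f∈near , c′f with near⁻ {S} {w} f∈near
    ... | h , ath , f∈S , o∈f with same-at ath | same-near ath f∈S (_ , joinsʳ (joins-other (proj₂ ath)) , o∈f) c′f
    ... | h∈T , _ | f∈T , eq =
      lose (near⁺ {T} (h∈T , proj₂ ath) f∈T (_ , joinsʳ (joins-other (proj₂ ath)) , o∈f)) (trans (sym eq) c′f)

  -- Adding an edge between two vertices of degree at most 2.

  module Join {S : EdgeSet} {e : Edge} (e∈S : e ∈ S) {c : Coloring G}
    (good : Good (S - e) c) (sep : Separates e (S - e) c) where

    private T = S - e

    -- By the last clause no edge but `e` gains a color `two i`, so that conditions on these colors
    -- carry over to the next edge to be added.
    Result : Set
    Result = ∃[ c′ ] (Good S c′ × ∀ {f} → f ≢ e → c′ f ≡ c f ⊎ c′ f ≡ one)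

    module _ {u v : Vertex} (j : Joins e u v) (du : deg S u ≤ 2) (dv : deg S v ≤ 2) where

      deg-T-u : deg T u ≤ 1
      deg-T-u = ≤-pred (≤-trans (deg-remove {S} (e∈S , joinsˡ j)) du)
      deg-T-v : deg T v ≤ 1
      deg-T-v = ≤-pred (≤-trans (deg-remove {S} (e∈S , joinsʳ j)) dv)

      -- The edges that can conflict with a color `two i` on `e`. There are at most six entries, as
      -- each end of `e` keeps at most one edge in `T`.
      around : List Edge
      around = near T v ++ near T u

      length-around : length around ≤ 6
      length-around = ≤-trans (≤-reflexive (length-++ (near T v)))
        (+-mono-≤ (length-near T v deg-T-v) (length-near T u deg-T-u))

      meets-end : ∀ {f} → Meets e f → Incident u f ⊎ Incident v f
      meets-end (x , x∈e , x∈f) with joins-ends j x∈e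
      ... | inj₁ refl = inj₁ x∈f
      ... | inj₂ refl = inj₂ x∈f

      ∈-around : ∀ {f g} → f ∈ T → g ∈ S → Meets e g → Meets g f → f ∈ˡ around
      ∈-around f∈T g∈S eg gf with split e g∈S
      ... | inj₁ refl = [ (λ u∈f → ∈-++⁺ʳ (near T v) (star⊆near {T} (f∈T , u∈f)))
                        , (λ v∈f → ∈-++⁺ˡ (star⊆near {T} (f∈T , v∈f))) ]′ (meets-end gf)
      ... | inj₂ (_ , g∈T) = [ (λ u∈g → ∈-++⁺ʳ (near T v) (near⁺ {T} (g∈T , u∈g) f∈T gf))
                             , (λ v∈g → ∈-++⁺ˡ (near⁺ {T} (g∈T , v∈g) f∈T gf)) ]′ (meets-end eg)

      -- A bad vertex that is `u` or `v` or a neighbor of one of them would have a neighbor of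
      -- degree at most 2. Any other vertex has unchanged edges, and the only changes it can see are
      -- to the color `one`.
      join-fair : ∀ {c′} → (∀ {f} → f ≢ e → c′ f ≡ c f ⊎ (c′ f ≡ one × (Incident u f ⊎ Incident v f))) → Fair S c′
      join-fair {c′} changes w d≤2 bad
        with any? (λ h → at? S w h ×-dec (incident? u h ⊎-dec incident? v h))
      ... | yes (h , ath , inj₁ u∈h) with w ≟ u
      ...   | yes refl = <⇒≱ (bad⇒2<deg-neighbor {S} {c′} d≤2 bad e∈S j) dv
      ...   | no  w≢u  = <⇒≱ (bad⇒2<deg-end {S} {c′} d≤2 bad ath u∈h w≢u) du
      join-fair {c′} changes w d≤2 bad | yes (h , ath , inj₂ v∈h) with w ≟ v
      ...   | yes refl = <⇒≱ (bad⇒2<deg-neighbor {S} {c′} d≤2 bad e∈S (joins-sym {e} j)) du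
      ...   | no  w≢v  = <⇒≱ (bad⇒2<deg-end {S} {c′} d≤2 bad ath v∈h w≢v) dv
      join-fair {c′} changes w d≤2 bad | no far =
        fair-transfer {S} {T} {c} {c′} (∈-remove⁻ S e) (proj₂ good) d≤2 at-w near-w bad
        where
        at-w : ∀ {h} → At S w h → h ∈ T × c′ h ≡ c h
        at-w {h} ath@(h∈S , w∈h) with split e h∈S
        ... | inj₁ refl = contradiction (h , ath , inj₁ (joinsˡ j)) far
        ... | inj₂ (h≢e , h∈T) with changes h≢e
        ...   | inj₁ eq = h∈T , eq
        ...   | inj₂ (_ , uv∈h) = contradiction (h , ath , uv∈h) far
        near-w : ∀ {i h f} → At S w h → f ∈ S → Meets h f → c′ f ≡ two i → f ∈ T × c′ f ≡ c f
        near-w {h = h} ath f∈S hf c′f with split e f∈S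
        ... | inj₁ refl = contradiction (h , ath , meets-end (meets-sym hf)) far
        ... | inj₂ (f≢e , f∈T) with changes f≢e
        ...   | inj₁ eq = f∈T , eq
        ...   | inj₂ (eq , _) = contradiction (trans (sym eq) c′f) one≢two

      -- All six colors occur around e, so each occurs only once; the color of the
      -- other edge b at v can be moved to e, and b recolored one.
      join-swap : (∀ i → Uses c around (two i)) → Uses c (star T u) one → Result
      join-swap twos ones with find ones
      ... | a , a∈ , ca = body
        where
        a∈near : a ∈ˡ near T u
        a∈near = star⊆near {T} (star⁻ {T} a∈)
        rainbow : Rainbow c around
        rainbow one     = lose (∈-++⁺ʳ (near T v) a∈near) ca
        rainbow (two i) = twos i
        no-repeat : ∀ {x y} → x ∈ˡ near T v → y ∈ˡ (near T v ∖ x) ++ near T u → c x ≢ c y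
        no-repeat x∈ y∈ eq = <-irrefl refl
          (≤-trans (repeat⇒7≤length c (near T v) (near T u) rainbow x∈ y∈ eq) length-around)
        not-one : ∀ {x} → x ∈ˡ near T v → c x ≢ one
        not-one x∈ eq = no-repeat x∈ (∈-++⁺ʳ _ a∈near) (trans eq (sym ca))
        body : Result
        body with any? (at? T v)
        -- Without a further edge at `v` all six colors would occur among the at most three entries
        -- of `near T u`.
        ... | no none = contradiction (≤-trans (rainbow⇒6≤length c rainbow′) (length-near T u deg-T-u))
                          λ { (s≤s (s≤s (s≤s ()))) }
          where
          rainbow′ : Rainbow c (near T u)
          rainbow′ k with find (rainbow k)
          ... | f , f∈ , eq with ∈-++⁻ (near T v) f∈
          ...   | inj₁ f∈v = let h , ath , _ = near⁻ {T} {v} f∈v in contradiction (h , ath) none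
          ...   | inj₂ f∈u = lose f∈u eq
        ... | yes (b , atb@(b∈T , v∈b)) with c b in cb
        ...   | one   = contradiction cb (not-one (star⊆near {T} atb))
        ...   | two k = c₂ , (packing₂ , join-fair changes) , λ f≢e → [ inj₁ , inj₂ ∘ proj₁ ]′ (changes f≢e)
          where
          c₁ = c [ b ≔ one ]
          c₂ = c₁ [ e ≔ two k ]
          recolored : ∀ {f i} → c₁ f ≡ two i → f ≢ b × c f ≡ two i
          recolored {f} eq with f ≟ b
          ... | yes refl = contradiction (trans (sym (≔-same c b)) eq) one≢two
          ... | no  f≢b  = f≢b , trans (sym (≔-other c f≢b)) eq
          packing₁ : Packing T c₁
          packing₁ = extend (packing-mono (∈-remove⁻ T b) (proj₁ good))
            (λ f∈ g∈ fb bg → induced (proj₁ good) (∈-remove⁻ T b f∈) b∈T (∈-remove⁻ T b g∈) fb bg)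
            (λ _ f∈ bf → not-one (near⁺ {T} atb (∈-remove⁻ T b f∈) bf))
            (λ ())
          packing₂ : Packing S c₂
          packing₂ = extend packing₁
            (λ f∈ g∈ fe eg c₁f c₁g → sep f∈ g∈ fe eg (proj₂ (recolored c₁f)) (proj₂ (recolored c₁g)))
            (λ ())
            λ { refl f∈ g∈ eg gf c₁f → let f≢b , cf = recolored c₁f in
                  no-repeat (star⊆near {T} atb)
                    ([ (λ f∈v → ∈-++⁺ˡ (∈∖ f∈v f≢b)) , ∈-++⁺ʳ _ ]′ (∈-++⁻ (near T v) (∈-around f∈ g∈ eg gf)))
                    (trans cb (sym cf)) }
          changes : ∀ {f} → f ≢ e → c₂ f ≡ c f ⊎ (c₂ f ≡ one × (Incident u f ⊎ Incident v f))
          changes {f} f≢e with f ≟ b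
          ... | yes refl = inj₂ (trans (≔-other c₁ f≢e) (≔-same c b) , inj₂ v∈b)
          ... | no  f≢b  = inj₁ (trans (≔-other c₁ f≢e) (≔-other c f≢b))

    -- A color `two i` free around `e` is preferred. If there is none, `e` gets `one` unless this
    -- color occurs at an end of `e`; then `join-swap` applies, with that end in the role of `u`.
    join : ∀ {u v} → Joins e u v → deg S u ≤ 2 → deg S v ≤ 2 → Result
    join {u} {v} j du dv with any? (λ i → ¬? (uses? c (around j du dv) (two i)))
    ... | yes (i , free) = c [ e ≔ two i ] ,
      (extend (proj₁ good) sep (λ ())
        (λ { refl f∈ g∈ eg gf cf → free (lose (∈-around j du dv f∈ g∈ eg gf) cf) })
      , join-fair j du dv (λ f≢e → inj₁ (≔-other c f≢e)))
      , λ f≢e → inj₁ (≔-other c f≢e)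
    ... | no all-used with uses? c (star T u) one | uses? c (star T v) one
    ...   | yes one-u | _ = join-swap j du dv twos one-u
      where
      twos : ∀ i → Uses c (around j du dv) (two i)
      twos i = decidable-stable (uses? c _ (two i)) (λ free → all-used (i , free))
    ...   | no _ | yes one-v = join-swap (joins-sym {e} j) dv du twos one-v
      where
      twos : ∀ i → Uses c (near T u ++ near T v) (two i)
      twos i = ++-comm (near T v) (near T u) (decidable-stable (uses? c _ (two i)) (λ free → all-used (i , free)))
    ...   | no ¬u | no ¬v = c [ e ≔ one ] ,
      (extend (proj₁ good) sep
        (λ _ f∈ ef cf → [ (λ u∈f → ¬u (lose (star⁺ {T} (f∈ , u∈f)) cf))
                        , (λ v∈f → ¬v (lose (star⁺ {T} (f∈ , v∈f)) cf)) ]′ (meets-end j du dv ef))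
        (λ ())
      , join-fair j du dv (λ f≢e → inj₁ (≔-other c f≢e)))
      , λ f≢e → inj₁ (≔-other c f≢e)

  -- Adding a pendant edge.

  module Pendant {S : EdgeSet} {e : Edge} (e∈S : e ∈ S) {u v : Vertex} (j : Joins e u v) (leaf : deg S u ≤ 1)
    {c : Coloring G} (good : Good (S - e) c) where

    private
      T = S - e

      T⊆S : T ⊆ S
      T⊆S = ∈-remove⁻ S e

      ate : At S u e
      ate = e∈S , joinsˡ j

      at-v : ∀ {f} → f ∈ T → Meets e f → Incident v f
      at-v f∈T (x , x∈e , x∈f) with joins-ends j x∈e
      ... | inj₁ refl = contradiction (only-edge {S} leaf ate (T⊆S f∈T , x∈f)) (∈-remove-≢ S e f∈T)
      ... | inj₂ refl = x∈f

      -- Since `u` is a leaf, edges brought together by `e` already meet at `v`.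
      separates : Separates e T c
      separates f∈ g∈ fe eg = induced (proj₁ good) f∈ f∈ g∈ meets-refl (v , at-v f∈ (meets-sym fe) , at-v g∈ eg)

      -- The leaf `u` has too small a degree to be bad, and `v` has the neighbor `u` of degree at
      -- most 2.
      off-e : ∀ {c′ w} → deg S w ≤ 2 → Bad S c′ w → ¬ Incident w e
      off-e {c′} {w} d≤2 bad w∈e with joins-ends j w∈e
      ... | inj₁ refl = <⇒≱ (bad⇒1<deg {S} {c′} bad) leaf
      ... | inj₂ refl = <⇒≱ (bad⇒2<deg-neighbor {S} {c′} d≤2 bad e∈S (joins-sym {e} j)) (≤-trans leaf (s≤s z≤n))

      away : ∀ {c′ w h} → deg S w ≤ 2 → Bad S c′ w → At S w h → h ≢ e × h ∈ T
      away {c′} d≤2 bad (h∈S , w∈h) with split e h∈S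
      ... | inj₁ refl = contradiction w∈h (off-e {c′} d≤2 bad)
      ... | inj₂ p = p

      joins-v : ∀ {c′ w h} → deg S w ≤ 2 → Bad S c′ w → At S w h → Incident v h → Joins h w v
      joins-v {c′} d≤2 bad (_ , w∈h) v∈h = joins w∈h v∈h λ { refl → off-e {c′} d≤2 bad (joinsʳ j) }

    -- The last clause confines recoloring to edges from `v` to vertices that are not leaves.
    -- `reduce-two-pairs` uses it to see that certain edges keep their colors.
    Result : Fin 5 → Set
    Result i = ∃[ c′ ] (Good S c′ ×
      (c′ e ≡ one ⊎ (c′ e ≡ two i × (∀ {f} → f ≢ e → c′ f ≡ c f))) ×
      (∀ {f} → f ≢ e → c′ f ≡ c f ⊎ ∃[ w ] (Joins f v w × 1 <ℕ deg S w)))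

    -- The color `one` on `e` counts only at the ends of `e`, neither of which can be bad.
    pendant-one : ¬ Uses c (star T v) one →
      ∃[ c′ ] (Good S c′ × c′ e ≡ one × (∀ {f} → f ≢ e → c′ f ≡ c f))
    pendant-one ¬one = c′ , (packing , fair) , ≔-same c e , ≔-other c
      where
      c′ = c [ e ≔ one ]
      packing : Packing S c′
      packing = extend (proj₁ good) separates
        (λ _ f∈ ef cf → ¬one (lose (star⁺ {T} (f∈ , at-v f∈ ef)) cf)) (λ ())
      fair : Fair S c′
      fair w d≤2 bad = fair-transfer {S} {T} {c} {c′} T⊆S (proj₂ good) d≤2
        (λ ath → let h≢e , h∈T = away {c′} d≤2 bad ath in h∈T , ≔-other c h≢e) near-w bad
        where
        near-w : ∀ {i h f} → At S w h → f ∈ S → Meets h f → c′ f ≡ two i → f ∈ T × c′ f ≡ c f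
        near-w _ f∈S _ c′f with split e f∈S
        ... | inj₁ refl = contradiction (trans (sym (≔-same c e)) c′f) one≢two
        ... | inj₂ (f≢e , f∈T) = f∈T , ≔-other c f≢e

    module _ {i : Fin 5} (unseen : ¬ Uses c (near T v) (two i))
      {g : Edge} (atg : At T v g) (cg : c g ≡ one) where

      private
        w₁ = other v g
        j₁ = joins-other (proj₂ atg)
        c₂ = c [ e ≔ two i ]

        g≢e : g ≢ e
        g≢e = ∈-remove-≢ S e (proj₁ atg)

        g∈S : g ∈ S
        g∈S = T⊆S (proj₁ atg)

        unseen′ : ∀ {f h} → f ∈ T → At T v h → Meets h f → c f ≢ two i
        unseen′ f∈T ath hf cf = unseen (lose (near⁺ {T} ath f∈T hf) cf)

        -- A neighbor w of v by another edge than g cannot be bad when v sees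
        -- one: both neighbors of w would see one.
        second-one : ∀ {c′ w h x} → deg S w ≤ 2 → Bad S c′ w → At S w h → Incident v h → h ≢ g →
          At S v x → c′ x ≡ one → (∀ {f} → f ∈ T → c′ f ≡ one → c f ≡ one) → ⊥
        second-one {c′} {w} {h} d≤2 bad ath v∈h h≢g atx c′x reflects with bad-edge {S} {c′} bad
        ... | f , atf , c′f = bad⇒≢ {S} {c′} d≤2 bad h≢f (proj₁ ath) (joins-v {c′} d≤2 bad ath v∈h)
            (proj₁ atf) (joins-other (proj₂ atf)) atx (proj₁ atf , joinsʳ (joins-other (proj₂ atf)))
            (trans c′x (sym c′f))
          where
          h≢f : h ≢ f
          h≢f refl = let _ , f∈T = away {c′} d≤2 bad atf in
            h≢g (matching (proj₁ good) f∈T (proj₁ atg) (v , v∈h , proj₂ atg) (reflects f∈T c′f) cg)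

      -- Only `v` and its neighbors see `e`. The end `w₁` of `g` is fine by hypothesis, and
      -- `second-one` takes care of the neighbors by other edges.
      pendant-direct : ¬ (deg S w₁ ≤ 2 × Bad S c₂ w₁) → Result i
      pendant-direct w₁-ok = c₂ , (packing , fair) ,
        inj₂ (≔-same c e , ≔-other c) , λ f≢e → inj₁ (≔-other c f≢e)
        where
        packing : Packing S c₂
        packing = extend (proj₁ good) separates (λ ()) two-free
          where
          two-free : ∀ {k f h} → two i ≡ two k → f ∈ T → h ∈ S → Meets e h → Meets h f → c f ≢ two k
          two-free refl f∈ h∈ eh hf with split e h∈
          ... | inj₁ refl = unseen′ f∈ (f∈ , at-v f∈ hf) meets-refl
          ... | inj₂ (_ , h∈T) = unseen′ f∈ (h∈T , at-v h∈T eh) hf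
        fair : Fair S c₂
        fair w d≤2 bad with any? (λ h → at? S w h ×-dec incident? v h)
        ... | yes (h , ath , v∈h) with h ≟ g
        ...   | yes refl = w₁-ok (subst (λ x → deg S x ≤ 2 × Bad S c₂ x)
          (sym (other-joins (joins-sym {g} (joins-v {c₂} d≤2 bad ath v∈h)))) (d≤2 , bad))
        ...   | no h≢g = second-one {c₂} d≤2 bad ath v∈h h≢g (g∈S , proj₂ atg) (trans (≔-other c g≢e) cg)
          λ f∈T c₂f → trans (sym (≔-other c (∈-remove-≢ S e f∈T))) c₂f
        fair w d≤2 bad | no far = fair-transfer {S} {T} {c} {c₂} T⊆S (proj₂ good) d≤2
          (λ ath → let h≢e , h∈T = away {c₂} d≤2 bad ath in h∈T , ≔-other c h≢e) near-w bad
          where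
          near-w : ∀ {k h f} → At S w h → f ∈ S → Meets h f → c₂ f ≡ two k → f ∈ T × c₂ f ≡ c f
          near-w {h = h} ath f∈S hf _ with split e f∈S
          ... | inj₂ (f≢e , f∈T) = f∈T , ≔-other c f≢e
          ... | inj₁ refl =
            contradiction (h , ath , at-v (proj₂ (away {c₂} d≤2 bad ath)) (meets-sym hf)) far

      -- As `w₁` is bad under `c₂`, no color occurs at both of its neighbors. The color `two i` of
      -- `e` occurs at `v`, hence not at the other neighbor, and this frees it for `g`; `e` then
      -- takes over `one`.
      pendant-swap : deg S w₁ ≤ 2 → Bad S c₂ w₁ → Result i
      pendant-swap d₁≤2 bad₁ = c₄ , (packing₄ , fair) ,
        inj₁ (≔-same c₃ e) , changes
        where
        c₃ = c [ g ≔ two i ]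
        c₄ = c₃ [ e ≔ one ]
        kept : ∀ {f} → f ≢ e → f ≢ g → c₄ f ≡ c f
        kept f≢e f≢g = trans (≔-other c₃ f≢e) (≔-other c f≢g)
        c₄g : c₄ g ≡ two i
        c₄g = trans (≔-other c₃ g≢e) (≔-same c g)
        not-g : ∀ {f} → c₃ f ≡ one → f ≢ g
        not-g c₃f refl = one≢two (trans (sym c₃f) (≔-same c g))
        packing₃ : Packing T c₃
        packing₃ = extend (packing-mono (∈-remove⁻ T g) (proj₁ good))
          (λ f∈ h∈ fg gh → induced (proj₁ good) (∈-remove⁻ T g f∈) (proj₁ atg) (∈-remove⁻ T g h∈) fg gh)
          (λ ()) two-free
          where
          two-free : ∀ {k f h} → two i ≡ two k → f ∈ T - g → h ∈ T → Meets g h → Meets h f → c f ≢ two k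
          two-free {f = f} {h} refl f∈ h∈ (x , x∈g , x∈h) (y , y∈h , y∈f) with joins-ends j₁ x∈g
          ... | inj₁ refl = unseen′ (∈-remove⁻ T g f∈) (h∈ , x∈h) (y , y∈h , y∈f)
          ... | inj₂ refl with joins-ends (joins-other x∈h) y∈h | h ≟ g
          ...   | inj₁ refl | _ = unseen′ (∈-remove⁻ T g f∈) atg (y , x∈g , y∈f)
          ...   | inj₂ _    | yes refl = unseen′ (∈-remove⁻ T g f∈) atg (y , y∈h , y∈f)
          -- Here `f` lies at the other neighbor of `w₁`, where the color of `e` cannot occur.
          ...   | inj₂ refl | no h≢g = λ cf →
            bad⇒≢ {S} {c₂} d₁≤2 bad₁ (λ g≡h → h≢g (sym g≡h)) g∈S (joins-sym {g} j₁) (T⊆S h∈) (joins-other x∈h)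
              (e∈S , joinsʳ j) (T⊆S f∈T , y∈f)
              (trans (≔-same c e) (sym (trans (≔-other c (∈-remove-≢ S e f∈T)) cf)))
            where f∈T = ∈-remove⁻ T g f∈
        packing₄ : Packing S c₄
        packing₄ = extend packing₃
          (λ f∈ h∈ fe eh → induced packing₃ f∈ f∈ h∈ meets-refl (v , at-v f∈ (meets-sym fe) , at-v h∈ eh))
          (λ _ f∈ ef c₃f → not-g c₃f (matching (proj₁ good) f∈ (proj₁ atg) (v , at-v f∈ ef , proj₂ atg)
            (trans (sym (≔-other c (not-g c₃f))) c₃f) cg))
          (λ ())
        reflects : ∀ {f} → f ∈ T → c₄ f ≡ one → c f ≡ one
        reflects f∈T c₄f = trans (sym (≔-other c (not-g c₃f))) c₃f
          where c₃f = trans (sym (≔-other c₃ (∈-remove-≢ S e f∈T))) c₄f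
        fair : Fair S c₄
        fair w d≤2 bad with any? (λ h → at? S w h ×-dec (incident? v h ⊎-dec incident? w₁ h))
        ... | yes (h , ath , inj₁ v∈h) with h ≟ g
        ...   | no h≢g = second-one {c₄} d≤2 bad ath v∈h h≢g (e∈S , joinsʳ j) (≔-same c₃ e) reflects
        -- Now `w` does not see `one` any more: `g` was its only edge of this color.
        ...   | yes refl with bad-edge {S} {c₄} bad
        ...     | f , atf , c₄f = one≢two (trans (sym c₄f) (subst (λ x → c₄ x ≡ two i) (sym f≡g) c₄g))
          where
          f∈T = proj₂ (away {c₄} d≤2 bad atf)
          f≡g = matching (proj₁ good) f∈T (proj₁ atg) (w , proj₂ atf , proj₂ ath) (reflects f∈T c₄f) cg
        fair w d≤2 bad | yes (h , ath , inj₂ w₁∈h) with w ≟ w₁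
        -- A bad vertex has no neighbor of degree at most 2 such as `w₁`.
        ...   | no w≢w₁ = <⇒≱ (bad⇒2<deg-end {S} {c₄} d≤2 bad ath w₁∈h w≢w₁) d₁≤2
        ...   | yes refl with bad-edge {S} {c₄} bad
        ...     | f , atf , c₄f = one≢two (trans (sym c₄f) (subst (λ x → c₄ x ≡ two i) (sym f≡g) c₄g))
          where
          f∈T = proj₂ (away {c₄} d≤2 bad atf)
          f≡g = matching (proj₁ good) f∈T (proj₁ atg) (w , proj₂ atf , joinsʳ j₁) (reflects f∈T c₄f) cg
        fair w d≤2 bad | no far = fair-transfer {S} {T} {c} {c₄} T⊆S (proj₂ good) d≤2 at-w near-w bad
          where
          at-w : ∀ {h} → At S w h → h ∈ T × c₄ h ≡ c h
          at-w {h} ath = let h≢e , h∈T = away {c₄} d≤2 bad ath in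
            h∈T , kept h≢e λ { refl → far (h , ath , inj₁ (proj₂ atg)) }
          near-w : ∀ {k h f} → At S w h → f ∈ S → Meets h f → c₄ f ≡ two k → f ∈ T × c₄ f ≡ c f
          near-w {h = h} {f} ath f∈S (x , x∈h , x∈f) c₄f with split e f∈S
          ... | inj₁ refl = contradiction (trans (sym (≔-same c₃ e)) c₄f) one≢two
          ... | inj₂ (f≢e , f∈T) = f∈T , kept f≢e λ { refl → far (h , ath ,
                  [ (λ { refl → inj₁ x∈h }) , (λ { refl → inj₂ x∈h }) ]′ (joins-ends j₁ x∈f)) }
        changes : ∀ {f} → f ≢ e → c₄ f ≡ c f ⊎ ∃[ w ] (Joins f v w × 1 <ℕ deg S w)
        changes {f} f≢e with f ≟ g
        ... | no  f≢g  = inj₁ (kept f≢e f≢g)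
        ... | yes refl = inj₂ (w₁ , j₁ , bad⇒1<deg {S} {c₂} bad₁)

    pendant : ∀ {i} → ¬ Uses c (near T v) (two i) → Result i
    pendant {i} unseen with uses? c (star T v) one
    ... | no ¬one = let c′ , good′ , c′e , same = pendant-one ¬one in c′ , good′ , inj₁ c′e , inj₁ ∘ same
    ... | yes ones with find ones
    ...   | g , g∈ , cg with (deg S (other v g) ≤? 2) ×-dec bad? S (c [ e ≔ two i ]) (other v g)
    ...     | yes (d≤2 , bad) = pendant-swap unseen (star⁻ {T} g∈) cg d≤2 bad
    ...     | no w₁-ok = pendant-direct unseen (star⁻ {T} g∈) cg w₁-ok

  -- Reducible configurations.

  separates-across : ∀ {T c e u v} → Packing T c → Joins e u v →
    (∀ {i f g} → At T u f → At T v g → c f ≡ two i → c g ≡ two i → f ≡ g) → Separates e T c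
  separates-across p j across f∈ g∈ (x , x∈f , x∈e) (y , y∈e , y∈g) cf cg
    with joins-ends j x∈e | joins-ends j y∈e
  -- Edges at the same end of `e` meet without it, so `across` is needed for opposite ends only.
  ... | inj₁ refl | inj₁ refl = induced p f∈ f∈ g∈ meets-refl (x , x∈f , y∈g) cf cg
  ... | inj₁ refl | inj₂ refl = across (f∈ , x∈f) (g∈ , y∈g) cf cg
  ... | inj₂ refl | inj₁ refl = sym (across (g∈ , y∈g) (f∈ , x∈f) cg cf)
  ... | inj₂ refl | inj₂ refl = induced p f∈ f∈ g∈ meets-refl (x , x∈f , y∈g) cf cg

  -- A removal could harm fairness by bringing a vertex of degree 3 down to degree 2. Only the ends
  -- of `e` lose an edge, and they have degree at most 2 already.
  good-remove : ∀ {S e c u v} → Joins e u v → deg S u ≤ 2 → deg S v ≤ 2 → Good S c → Good (S - e) c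
  good-remove {S} {e} {c} {u} {v} j du dv (p , fair) = packing-mono T⊆S p , fair′
    where
    T = S - e
    T⊆S : T ⊆ S
    T⊆S = ∈-remove⁻ S e
    low : ∀ w → deg T w ≤ 2 → deg S w ≤ 2
    low w d≤2 with incident? w e
    ... | no w∉e = ≤-trans (deg-mono {T} {S} w (λ w∈f f∈S → ∈-remove⁺ f∈S λ { refl → w∉e w∈f })) d≤2
    ... | yes w∈e with joins-ends j w∈e
    ...   | inj₁ refl = du
    ...   | inj₂ refl = dv
    fair′ : Fair T c
    fair′ w d≤2 (one∈ , twos) = fair w (low w d≤2) (one∈′ , two∈′)
      where
      one∈′ : Uses c (star S w) one
      one∈′ with find one∈
      ... | f , f∈ , cf = let f∈T , w∈f = star⁻ {T} f∈ in lose (star⁺ {S} (T⊆S f∈T , w∈f)) cf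
      two∈′ : ∀ i → Uses c (near S w) (two i)
      two∈′ i with find (twos i)
      ... | f , f∈ , cf with near⁻ {T} {w} f∈
      ... | h , (h∈T , w∈h) , f∈T , o∈f =
        lose (near⁺ {S} (T⊆S h∈T , w∈h) (T⊆S f∈T) (_ , joinsʳ (joins-other w∈h) , o∈f)) cf

  -- The condition on v lets an edge joining v to the pendant end of a be added next.
  Filled : EdgeSet → Edge → Vertex → Vertex → Coloring G → Set
  Filled T a p v c = ∃[ c′ ] (Good T c′ ×
    (∀ {k g} → At T v g → c′ a ≡ two k → c′ g ≡ two k → a ≡ g) ×
    (∀ {f} → f ≢ a → c′ f ≡ c f ⊎ ∃[ w ] (Joins f p w × 1 <ℕ deg T w)))

  -- If `one` occurs at `p`, then the at most five entries of `near U p` and `star U v` include this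
  -- color, so some `two i` is missing from both and serves for `a`.
  fill : ∀ {T a u p c} → a ∈ T → Joins a u p → deg T u ≤ 1 → Good (T - a) c →
    length (near (T - a) p) ≤ 4 → ∀ v → deg (T - a) v ≤ 1 →
    Filled T a p v c
  fill {T} {a} {u} {p} {c} a∈T j leaf good few v dv = body
    where
    U = T - a
    open Pendant a∈T j leaf good
    L = near U p ++ star U v
    length-L : length L ≤ 5
    length-L = ≤-trans (≤-reflexive (length-++ (near U p))) (+-mono-≤ few dv)
    body : Filled T a p v c
    body with uses? c (star U p) one
    ... | no ¬one = let c′ , good′ , c′a , same = pendant-one ¬one in
      c′ , good′ , (λ _ eq _ → contradiction (trans (sym c′a) eq) one≢two) , inj₁ ∘ same
    ... | yes ones with any? (λ i → ¬? (uses? c L (two i))) | find ones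
    ...   | no all-used | f , f∈ , cf = contradiction (≤-trans (rainbow⇒6≤length c rainbow) length-L) (<-irrefl refl)
      where
      rainbow : Rainbow c L
      rainbow one     = lose (∈-++⁺ˡ (star⊆near {U} (star⁻ {U} f∈))) cf
      rainbow (two i) = decidable-stable (uses? c L (two i)) (λ free → all-used (i , free))
    ...   | yes (i , free) | _ with pendant {i} (free ∘ ++⁺ˡ)
    ...     | c′ , good′ , inj₁ c′a , changes =
      c′ , good′ , (λ _ eq _ → contradiction (trans (sym c′a) eq) one≢two) , changes
    ...     | c′ , good′ , inj₂ (c′a , same) , changes = c′ , good′ , apart , changes
      where
      apart : ∀ {k g} → At T v g → c′ a ≡ two k → c′ g ≡ two k → a ≡ g
      apart (g∈T , v∈g) c′a≡k c′g with split a g∈T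
      ... | inj₁ refl = refl
      ... | inj₂ (g≢a , g∈U) = contradiction
        (++⁺ʳ (near U p) (lose (star⁺ {U} (g∈U , v∈g)) (trans (sym (same g≢a)) (trans c′g (trans (sym c′a≡k) c′a))))) free

  Smaller : EdgeSet → Set
  Smaller S = ∀ T → ∣ T ∣ <ℕ ∣ S ∣ → ∃ (Good T)

  high∉ : ∀ {S e u v x} → Joins e u v → deg S u ≤ 2 → deg S v ≤ 2 → 2 <ℕ deg S x → ¬ Incident x e
  high∉ j du dv dx x∈e with joins-ends j x∈e
  ... | inj₁ refl = <⇒≱ dx du
  ... | inj₂ refl = <⇒≱ dx dv

  -- Without `e` the vertex `v` has degree at most 2, so by fairness it misses `one` or some
  -- `two i`.
  reduce-leaf : ∀ {S e u v} → Smaller S → e ∈ S → Joins e u v → deg S u ≤ 1 → ∃ (Good S)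
  reduce-leaf {S} {e} {u} {v} smaller e∈S j leaf with smaller (S - e) (x∈p⇒∣p-x∣<∣p∣ e∈S)
  ... | c , good@(_ , fair) = body
    where
    T = S - e
    open Pendant e∈S j leaf good
    body : ∃ (Good S)
    body with uses? c (star T v) one
    ... | no ¬one = let c′ , good′ , _ = pendant-one ¬one in c′ , good′
    ... | yes ones with any? (λ i → ¬? (uses? c (near T v) (two i)))
    ...   | yes (i , unseen) = let c′ , good′ , _ = pendant unseen in c′ , good′
    ...   | no all-seen = contradiction
      (ones , λ i → decidable-stable (uses? c (near T v) (two i)) (λ unseen → all-seen (i , unseen)))
      (fair v (≤-pred (≤-trans (deg-remove {S} (e∈S , joinsʳ j)) (deg≤3 S v))))

  -- When `e` is put back, `a` is the only other edge at `u`, and `fill` has kept its color apart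
  -- from the edge at `v`.
  reduce-pair : ∀ {S e a u v p} → Smaller S → e ∈ S → Joins e u v → deg S u ≤ 2 → deg S v ≤ 2 →
    a ∈ S → Joins a u p → a ≢ e → length (near (S - e - a) p) ≤ 4 → ∃ (Good S)
  reduce-pair {S} {e} {a} {u} {v} {p} smaller e∈S j du dv a∈S ja a≢e few
    with smaller (S - e - a) (<-trans (x∈p⇒∣p-x∣<∣p∣ (∈-remove⁺ a∈S a≢e)) (x∈p⇒∣p-x∣<∣p∣ e∈S))
  ... | c , good with fill (∈-remove⁺ a∈S a≢e) ja (Dᵤ) good few v Dᵥ
    where
    Dᵤ = ≤-pred (≤-trans (deg-remove {S} (e∈S , joinsˡ j)) du)
    Dᵥ = ≤-trans (deg-remove≤ (S - e) a v) (≤-pred (≤-trans (deg-remove {S} (e∈S , joinsʳ j)) dv))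
  ...   | c₁ , good₁ , apart , _ =
    let c₂ , good₂ , _ = Join.join e∈S good₁ (separates-across (proj₁ good₁) j across) j du dv in c₂ , good₂
    where
    T = S - e
    across : ∀ {i f g} → At T u f → At T v g → c₁ f ≡ two i → c₁ g ≡ two i → f ≡ g
    across atf atg c₁f c₁g
      with only-edge {T} (≤-pred (≤-trans (deg-remove {S} (e∈S , joinsˡ j)) du)) (∈-remove⁺ a∈S a≢e , joinsˡ ja) atf
    ... | refl = apart atg c₁f c₁g

  -- The edge `e′` is still present when the induction hypothesis is applied, which forces its
  -- neighboring edges `a′` and the one at `w′` not to share a color `two i`. Only then is it
  -- removed, to make room for `a`, and later joined again.
  reduce-two-pairs : ∀ {S p u v w w′ a a′ e e′} → Smaller S → 2 <ℕ deg S p →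
    a ∈ S → Joins a u p → a′ ∈ S → Joins a′ w p → a ≢ a′ →
    e ∈ S → Joins e u v → e′ ∈ S → Joins e′ w w′ →
    deg S u ≤ 2 → deg S v ≤ 2 → deg S w ≤ 2 → deg S w′ ≤ 2 → ∃ (Good S)
  reduce-two-pairs {S} {p} {u} {v} {w} {w′} {a} {a′} {e} {e′}
    smaller dp a∈S ja a′∈S ja′ a≢a′ e∈S j e′∈S j′ du dv dw dw′ = body
    where
    p∉e : ¬ Incident p e
    p∉e = high∉ {S} j du dv dp
    p∉e′ : ¬ Incident p e′
    p∉e′ = high∉ {S} j′ dw dw′ dp
    a≢e : a ≢ e
    a≢e refl = p∉e (joinsʳ ja)
    a′≢e : a′ ≢ e
    a′≢e refl = p∉e (joinsʳ ja′)
    a≢e′ : a ≢ e′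
    a≢e′ refl = p∉e′ (joinsʳ ja)
    a′≢e′ : a′ ≢ e′
    a′≢e′ refl = p∉e′ (joinsʳ ja′)
    T = S - e
    a∈T : a ∈ T
    a∈T = ∈-remove⁺ a∈S a≢e
    a′∈T : a′ ∈ T
    a′∈T = ∈-remove⁺ a′∈S a′≢e
    du-T : deg T u ≤ 1
    du-T = ≤-pred (≤-trans (deg-remove {S} (e∈S , joinsˡ j)) du)
    dv-T : deg T v ≤ 1
    dv-T = ≤-pred (≤-trans (deg-remove {S} (e∈S , joinsʳ j)) dv)
    a-meets-a′ : Meets a a′
    a-meets-a′ = p , joinsʳ ja , joinsʳ ja′

    distinct : e′ ≢ e → ∃ (Good S)
    distinct e′≢e = body′
      where
      e′∈T : e′ ∈ T
      e′∈T = ∈-remove⁺ e′∈S e′≢e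
      T₁ = T - e′
      U  = T₁ - a
      a∈T₁ : a ∈ T₁
      a∈T₁ = ∈-remove⁺ a∈T a≢e′
      a′∈T₁ : a′ ∈ T₁
      a′∈T₁ = ∈-remove⁺ a′∈T a′≢e′
      dw-T : deg T w ≤ 2
      dw-T = ≤-trans (deg-remove≤ S e w) dw
      dw′-T : deg T w′ ≤ 2
      dw′-T = ≤-trans (deg-remove≤ S e w′) dw′
      dw-T₁ : deg T₁ w ≤ 1
      dw-T₁ = ≤-pred (≤-trans (deg-remove {T} (e′∈T , joinsˡ j′)) dw-T)
      few : length (near U p) ≤ 4
      -- At most two edges remain at `p`, and the one to `w` contributes at most one entry: 3 + 1 =
      -- 4.
      few = ≤-pred (≤-pred (length-near-slack {d = 2} U p
        (≤-pred (≤-trans (deg-remove {T₁} (a∈T₁ , joinsʳ ja)) (deg≤3 T₁ p)))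
        (∈-remove⁺ a′∈T₁ (≢-sym a≢a′)) (joins-sym {a′} ja′)
        (s≤s (s≤s (≤-trans (deg-remove≤ T₁ a w) dw-T₁)))))
      body′ : ∃ (Good S)
      body′ with smaller (T - a) (<-trans (x∈p⇒∣p-x∣<∣p∣ a∈T) (x∈p⇒∣p-x∣<∣p∣ e∈S))
      ... | c , good with fill a∈T₁ ja (≤-trans (deg-remove≤ T e′ u) du-T)
            (subst (λ X → Good X c) (p─x─y≡p─y─x T a e′)
              (good-remove j′ (≤-trans (deg-remove≤ T a w) dw-T) (≤-trans (deg-remove≤ T a w′) dw′-T) good))
            few v (≤-trans (deg-remove≤ T₁ a v) (≤-trans (deg-remove≤ T e′ v) dv-T))
      ... | c₁ , good₁ , apart , changes
          with Join.join e′∈T good₁ (separates-across (proj₁ good₁) j′ across′) j′ dw-T dw′-T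
        where
        across′ : ∀ {i f g} → At T₁ w f → At T₁ w′ g → c₁ f ≡ two i → c₁ g ≡ two i → f ≡ g
        across′ {g = g} atf (g∈ , w′∈g) c₁f c₁g with only-edge {T₁} dw-T₁ (a′∈T₁ , joinsˡ ja′) atf | incident? p g
        ... | refl | yes p∈g = induced (proj₁ good₁) a′∈T₁ a′∈T₁ g∈ meets-refl (p , joinsʳ ja′ , p∈g) c₁f c₁g
        ... | refl | no p∉g with changes (≢-sym a≢a′) | changes {g} (λ { refl → p∉g (joinsʳ ja) })
        -- The edge `a′` was not recolored, since its end `w` is a leaf in `T₁`.
        ...   | inj₂ (x , jx , dx) | _ = contradiction
          (subst (λ y → deg T₁ y ≤ 1) (trans (sym (other-joins (joins-sym {a′} ja′))) (other-joins jx)) dw-T₁) (<⇒≱ dx)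
        ...   | inj₁ _ | inj₂ (x , jx , _) = contradiction (joinsˡ jx) p∉g
        -- Both edges have their original colors, from a packing in which `e′` links them.
        ...   | inj₁ eq′ | inj₁ eq = induced (proj₁ good) (∈-remove⁺ a′∈T (≢-sym a≢a′))
          (∈-remove⁺ e′∈T (≢-sym a≢e′))
          (∈-remove⁺ (∈-remove⁻ T e′ g∈) λ { refl → p∉g (joinsʳ ja) })
          (w , joinsˡ ja′ , joinsˡ j′) (w′ , joinsʳ j′ , w′∈g) (trans (sym eq′) c₁f) (trans (sym eq) c₁g)
      ... | c₂ , good₂ , changes₂ =
        let c₃ , good₃ , _ = Join.join e∈S good₂ (separates-across (proj₁ good₂) j across) j du dv in c₃ , good₃
        where
        before : ∀ {i f} → f ≢ e′ → c₂ f ≡ two i → c₁ f ≡ two i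
        before f≢e′ c₂f with changes₂ f≢e′
        ... | inj₁ eq = trans (sym eq) c₂f
        ... | inj₂ eq = contradiction (trans (sym eq) c₂f) one≢two
        across : ∀ {i f g} → At T u f → At T v g → c₂ f ≡ two i → c₂ g ≡ two i → f ≡ g
        across atf (g∈T , v∈g) c₂f c₂g with only-edge {T} du-T (a∈T , joinsˡ ja) atf | split e′ g∈T
        ... | refl | inj₂ (g≢e′ , g∈T₁) = apart (g∈T₁ , v∈g) (before a≢e′ c₂f) (before g≢e′ c₂g)
        -- Here `e′` ends at `v`. If `v` is `w′`, then `a′` links `a` to `e′`, so the packing keeps
        -- their colors apart; if `v` is `w`, it has the three edges `a′`, `e′` and `e`.
        ... | refl | inj₁ refl with joins-ends j′ v∈g
        ...   | inj₂ refl = induced (proj₁ good₂) a∈T a′∈T e′∈T a-meets-a′ (w , joinsˡ ja′ , joinsˡ j′) c₂f c₂g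
        ...   | inj₁ refl with two-edges {S} dv a′≢e′ (a′∈S , joinsˡ ja′) (e′∈S , joinsˡ j′) (e∈S , joinsʳ j)
        ...     | inj₁ refl = contradiction refl a′≢e
        ...     | inj₂ refl = contradiction refl e′≢e

    body : ∃ (Good S)
    body with e′ ≟ e
    ... | no e′≢e = distinct e′≢e
    -- If `w` is `u`, there are three edges at `u`. Otherwise `w` is `v`, and `p`, `u`, `v` form a
    -- triangle: `a` and `a′` meet at `p`, and it suffices to delete `e`.
    ... | yes refl with smaller T (x∈p⇒∣p-x∣<∣p∣ e∈S) | joins-ends j (joinsˡ j′)
    ...   | _ | inj₁ refl with two-edges {S} du a≢a′ (a∈S , joinsˡ ja) (a′∈S , joinsˡ ja′) (e∈S , joinsˡ j)
    ...     | inj₁ refl = contradiction refl a≢e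
    ...     | inj₂ refl = contradiction refl a′≢e
    body | yes refl | c , good | inj₂ refl =
      let c′ , good′ , _ = Join.join e∈S good (separates-across (proj₁ good) j across) j du dv in c′ , good′
      where
      across : ∀ {i f g} → At T u f → At T v g → c f ≡ two i → c g ≡ two i → f ≡ g
      across atf atg cf cg with only-edge {T} du-T (a∈T , joinsˡ ja) atf | only-edge {T} dv-T (a′∈T , joinsˡ ja′) atg
      ... | refl | refl = induced (proj₁ good) a∈T a∈T a′∈T meets-refl a-meets-a′ cf cg

  -- Discharging.

  module Discharge (S : EdgeSet) where

    Low : Vertex → Set
    Low v = deg S v ≤ 2

    low? : ∀ v → Dec (Low v)
    low? v = deg S v ≤? 2

    Paired : Vertex → Set
    Paired v = Any (λ h → Low (other v h)) (star S v)

    paired? : ∀ v → Dec (Paired v)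
    paired? v = Any.any? (λ h → low? (other v h)) (star S v)

    charge : Vertex → Edge → ℕ
    charge v e = share (does (low? v)) (does (low? w)) (does (paired? v)) (does (paired? w))
      where w = other v e

    total : Vertex → ℕ
    total v = sum (map (charge v) (star S v))

    charge-ends : ∀ e → charge (src e) e + charge (tgt e) e ≡ 10
    charge-ends e rewrite other-joins {e} (inj₁ (refl , refl)) | other-joins {e} (inj₂ (refl , refl)) =
      share-sum (does (low? (src e))) (does (low? (tgt e))) (does (paired? (src e))) (does (paired? (tgt e)))

    -- Double counting: after exchanging the sums, an edge of `S` collects the charges of its two
    -- ends, which are 10 together.
    ∑-total : ∑ total ≤ 10 * ∣ S ∣
    ∑-total = begin
      ∑ total
        ≡⟨ sum-cong-≗ (λ v → sum-filter-tabulate (at? S v) (charge v) id) ⟩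
      ∑ (λ v → ∑ (λ e → if does (at? S v e) then charge v e else 0))
        ≡⟨ ∑-comm (λ v e → if does (at? S v e) then charge v e else 0) ⟩
      ∑ (λ e → ∑ (λ v → if does (at? S v e) then charge v e else 0))
        ≤⟨ ∑-mono per-edge ⟩
      ∑ (λ e → if does (e ∈? S) then 10 else 0)
        ≡⟨ ∑-subset S 10 ⟩
      10 * ∣ S ∣ ∎
      where
      open ≤-Reasoning
      both-ends : ∀ e v → At S v e → (v ≡ src e × charge v e ≤ charge (src e) e) ⊎ (v ≡ tgt e × charge v e ≤ charge (tgt e) e)
      both-ends e v (_ , inj₁ refl) = inj₁ (refl , ≤-refl)
      both-ends e v (_ , inj₂ refl) = inj₂ (refl , ≤-refl)
      from-dec : ∀ e (e∈? : Dec (e ∈ S)) →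
        ∑ (λ v → if does (at? S v e) then charge v e else 0) ≤ (if does e∈? then 10 else 0)
      from-dec e (no e∉S) = ≤-trans (∑-mono (λ v → if-no (at? S v e) (e∉S ∘ proj₁)))
        (≤-reflexive (sum-replicate-zero order))
      from-dec e (yes _) = ≤-trans
        (∑-mono (λ v → if-either (at? S v e) (v ≟ src e) (v ≟ tgt e) (both-ends e v)))
        (≤-reflexive (trans (∑-distrib-+ {order} _ _)
          (trans (cong₂ _+_ (∑-indicator (src e) _) (∑-indicator (tgt e) _)) (charge-ends e))))
      per-edge : ∀ e → ∑ (λ v → if does (at? S v e) then charge v e else 0) ≤ (if does (e ∈? S) then 10 else 0)
      per-edge e = from-dec e (e ∈? S)

    module _ {v : Vertex} {e : Edge} where

      private w = other v e

      low⇒5≤charge : Low v → 5 ≤ charge v e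
      low⇒5≤charge lv rewrite dec-true (low? v) lv = lemma (does (low? w)) (does (paired? v)) (does (paired? w))
        where
        lemma : ∀ b p q → 5 ≤ share true b p q
        lemma true  _     _ = ≤-refl
        lemma false true  _ = m≤m+n 5 2
        lemma false false _ = m≤m+n 5 1

      low-high⇒6≤charge : Low v → ¬ Low w → 6 ≤ charge v e
      low-high⇒6≤charge lv hw rewrite dec-true (low? v) lv | dec-false (low? w) hw = lemma (does (paired? v))
        where
        lemma : ∀ p → 6 ≤ share true false p (does (paired? w))
        lemma true  = m≤m+n 6 1
        lemma false = ≤-refl

      paired-high⇒7≤charge : Low v → ¬ Low w → Paired v → 7 ≤ charge v e
      paired-high⇒7≤charge lv hw pv rewrite dec-true (low? v) lv | dec-false (low? w) hw | dec-true (paired? v) pv = ≤-refl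

      high⇒3≤charge : ¬ Low v → 3 ≤ charge v e
      high⇒3≤charge hv rewrite dec-false (low? v) hv = lemma (does (low? w)) (does (paired? w))
        where
        lemma : ∀ b q → 3 ≤ share false b (does (paired? v)) q
        lemma true  true  = ≤-refl
        lemma true  false = m≤m+n 3 1
        lemma false _     = m≤m+n 3 2

      unpaired⇒4≤charge : ¬ Low v → ¬ (Low w × Paired w) → 4 ≤ charge v e
      unpaired⇒4≤charge hv ¬lp rewrite dec-false (low? v) hv = lemma (low? w) (paired? w) ¬lp
        where
        lemma : ∀ {A B : Set} (a? : Dec A) (b? : Dec B) → ¬ (A × B) →
          4 ≤ share false (does a?) (does (paired? v)) (does b?)
        lemma (yes a) (yes b) ¬ab = contradiction (a , b) ¬ab
        lemma (yes _) (no _)  _   = ≤-refl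
        lemma (no _)  _       _   = m≤m+n 4 1

      high-high⇒5≤charge : ¬ Low v → ¬ Low w → 5 ≤ charge v e
      high-high⇒5≤charge hv hw rewrite dec-false (low? v) hv | dec-false (low? w) hw = ≤-refl

    support : Subset order
    support = Vec.tabulate (λ v → does (1 ≤? deg S v))

    ∈-support⁺ : ∀ {v e} → At S v e → v ∈ support
    ∈-support⁺ {v} at = lookup⇒[]= v support (trans (lookup∘tabulate _ v) (dec-true (1 ≤? deg S v) (nonempty (star⁺ {S} at))))
      where
      nonempty : ∀ {e} {L : List Edge} → e ∈ˡ L → 1 ≤ length L
      nonempty (here _)  = s≤s z≤n
      nonempty (there _) = s≤s z≤n

    ∈-support⁻ : ∀ {v} → v ∈ support → 1 ≤ deg S v
    ∈-support⁻ {v} v∈ = from-does (1 ≤? deg S v) (trans (sym (lookup∘tabulate _ v)) ([]=⇒lookup v∈))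
      where
      from-does : ∀ {A : Set} (a? : Dec A) → does a? ≡ true → A
      from-does (yes a) _ = a

    module _ (smaller : Smaller S) where

      -- An instance of `reduce-pair` with room to spare: `p` has degree at most 2 and loses `e₂`,
      -- so `near` has at most three entries.
      reduce-low-triple : ∀ {v e₁ e₂} → Low v → At S v e₁ → At S v e₂ → e₁ ≢ e₂ →
        Low (other v e₁) → Low (other v e₂) → ∃ (Good S)
      reduce-low-triple {v} {e₁} {e₂} lv at₁ at₂ e₁≢e₂ l₁ l₂ =
        reduce-pair smaller (proj₁ at₁) (joins-other (proj₂ at₁)) lv l₁ (proj₁ at₂) j₂ (≢-sym e₁≢e₂)
          (≤-trans (length-near (S - e₁ - e₂) p (≤-pred (≤-trans
            (deg-remove {S - e₁} (∈-remove⁺ (proj₁ at₂) (≢-sym e₁≢e₂) , joinsʳ j₂))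
            (≤-trans (deg-remove≤ S e₁ p) l₂)))) (m≤m+n 3 1))
        where
        p  = other v e₂
        j₂ = joins-other (proj₂ at₂)

      module _ {p : Vertex} (high : ¬ Low p) where

        -- After the deletions `p` has at most two edges, each leading to a vertex of degree at most
        -- 2, which gives the four entries allowed in `reduce-pair`.
        reduce-all-low : ∀ {a} → At S p a → Low (other p a) → Paired (other p a) →
          (∀ {g} → At S p g → g ≢ a → Low (other p g)) → ∃ (Good S)
        reduce-all-low {a} (a∈S , p∈a) lu paired others with find paired
        ... | h , h∈ , lv with star⁻ {S} h∈
        ... | h∈S , u∈h = reduce-pair smaller h∈S jh lu lv a∈S (joins-sym {a} ja) a≢h
            (≤-trans (length-concatMap (λ g → star U (other p g)) (star U p) few) (*-monoˡ-≤ 2 deg-U-p))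
          where
          ja = joins-other p∈a
          jh = joins-other u∈h
          U  = S - h - a
          p∉h : ¬ Incident p h
          p∉h = high∉ {S} jh lu lv (≰⇒> high)
          a≢h : a ≢ h
          a≢h refl = p∉h p∈a
          deg-U-p : deg U p ≤ 2
          deg-U-p = ≤-pred (≤-trans (deg-remove {S - h} (∈-remove⁺ a∈S a≢h , p∈a)) (deg≤3 (S - h) p))
          few : ∀ {g} → g ∈ˡ star U p → length (star U (other p g)) ≤ 2
          few {g} g∈ with star⁻ {U} g∈
          ... | g∈U , p∈g = ≤-trans (deg-mono {S} {U} (other p g) (λ _ → ∈-remove⁻ S h ∘ ∈-remove⁻ (S - h) a))
            (others (∈-remove⁻ S h (∈-remove⁻ (S - h) a g∈U) , p∈g) (∈-remove-≢ (S - h) a g∈U))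

        reduce-two-paired : ∀ {a a′} → At S p a → At S p a′ → a ≢ a′ →
          Low (other p a) × Paired (other p a) → Low (other p a′) × Paired (other p a′) → ∃ (Good S)
        reduce-two-paired (a∈S , p∈a) (a′∈S , p∈a′) a≢a′ (lu , pu) (lw , pw) with find pu | find pw
        ... | h , h∈ , lv | h′ , h′∈ , lw′ with star⁻ {S} h∈ | star⁻ {S} h′∈
        ... | h∈S , u∈h | h′∈S , w∈h′ = reduce-two-pairs smaller (≰⇒> high)
          a∈S (joins-sym (joins-other p∈a)) a′∈S (joins-sym (joins-other p∈a′)) a≢a′
          h∈S (joins-other u∈h) h′∈S (joins-other w∈h′) lu lv lw lw′

        -- By `reduce-all-low`, one of the other two neighbors may be assumed to have degree 3. The
        -- charges are then at least 3 at `x`, 5 at that neighbor and 4 at the last one.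
        reduce-one-paired : ∀ {x y z} → At S p x → (∀ {g} → At S p g → g ≡ x ⊎ g ≡ y ⊎ g ≡ z) →
          Low (other p x) × Paired (other p x) →
          ¬ (Low (other p y) × Paired (other p y)) → ¬ (Low (other p z) × Paired (other p z)) →
          ∃ (Good S) ⊎ 12 ≤ charge p x + (charge p y + charge p z)
        reduce-one-paired {x} {y} {z} atx cover (lx , px) ¬y ¬z with low? (other p y) | low? (other p z)
        ... | yes ly | yes lz = inj₁ (reduce-all-low atx lx px others)
          where
          others : ∀ {g} → At S p g → g ≢ x → Low (other p g)
          others atg g≢x with cover atg
          ... | inj₁ g≡x         = contradiction g≡x g≢x
          ... | inj₂ (inj₁ refl) = ly
          ... | inj₂ (inj₂ refl) = lz
        ... | no hy | _ = inj₂ (+-mono-≤ (high⇒3≤charge high) (+-mono-≤ (high-high⇒5≤charge high hy) (unpaired⇒4≤charge high ¬z)))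
        ... | yes _ | no hz = inj₂ (+-mono-≤ (high⇒3≤charge high) (+-mono-≤ (unpaired⇒4≤charge high ¬y) (high-high⇒5≤charge high hz)))

        reduce-high : ∀ {x y z} → At S p x → At S p y → At S p z → x ≢ y → x ≢ z → y ≢ z →
          (∀ {g} → At S p g → g ≡ x ⊎ g ≡ y ⊎ g ≡ z) →
          ∃ (Good S) ⊎ 12 ≤ charge p x + (charge p y + charge p z)
        reduce-high {x} {y} {z} atx aty atz x≢y x≢z y≢z cover
          with low? (other p x) ×-dec paired? (other p x)
             | low? (other p y) ×-dec paired? (other p y)
             | low? (other p z) ×-dec paired? (other p z)
        ... | yes px | yes py | _      = inj₁ (reduce-two-paired atx aty x≢y px py)
        ... | yes px | no _   | yes pz = inj₁ (reduce-two-paired atx atz x≢z px pz)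
        ... | no _   | yes py | yes pz = inj₁ (reduce-two-paired aty atz y≢z py pz)
        ... | yes px | no ¬y  | no ¬z  = reduce-one-paired atx cover px ¬y ¬z
        ... | no ¬x  | yes py | no ¬z  = map₂ (subst (12 ≤_) (x∙yz≈y∙xz (charge p y) (charge p x) (charge p z)))
          (reduce-one-paired aty (λ atg → [ inj₂ ∘ inj₁ , [ inj₁ , inj₂ ∘ inj₂ ]′ ]′ (cover atg)) py ¬x ¬z)
        ... | no ¬x  | no ¬y  | yes pz = map₂ (subst (12 ≤_) (x∙yz≈y∙zx (charge p z) (charge p x) (charge p y)))
          (reduce-one-paired atz (λ atg → [ inj₂ ∘ inj₁ , [ inj₂ ∘ inj₂ , inj₁ ]′ ]′ (cover atg)) pz ¬x ¬y)
        ... | no ¬x  | no ¬y  | no ¬z  = inj₂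
          (+-mono-≤ (unpaired⇒4≤charge high ¬x) (+-mono-≤ (unpaired⇒4≤charge high ¬y) (unpaired⇒4≤charge high ¬z)))

      -- Exactly one low neighbor makes `v` paired and the charges 5 + 7; no low neighbor gives 6 +
      -- 6.
      reduce-low : ∀ {v x y} → Low v → At S v x → At S v y → x ≢ y → ∃ (Good S) ⊎ 12 ≤ charge v x + charge v y
      reduce-low {v} {x} {y} lv atx aty x≢y with low? (other v x) | low? (other v y)
      ... | yes lx | yes ly = inj₁ (reduce-low-triple lv atx aty x≢y lx ly)
      ... | yes lx | no hy  = inj₂ (+-mono-≤ (low⇒5≤charge lv) (paired-high⇒7≤charge lv hy (lose (star⁺ {S} atx) lx)))
      ... | no hx  | yes ly = inj₂ (+-mono-≤ (paired-high⇒7≤charge lv hx (lose (star⁺ {S} aty) ly)) (low⇒5≤charge lv))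
      ... | no hx  | no hy  = inj₂ (+-mono-≤ (low-high⇒6≤charge lv hx) (low-high⇒6≤charge lv hy))

      reduce-at : ∀ v L → star S v ≡ L → Unique L → ∃ (Good S) ⊎ (0 <ℕ length L → 12 ≤ sum (map (charge v) L))
      reduce-at v [] eq _ = inj₂ λ ()
      reduce-at v (x ∷ []) eq _ with star⁻ {S} (subst (x ∈ˡ_) (sym eq) (here refl))
      ... | x∈S , v∈x = inj₁ (reduce-leaf smaller x∈S (joins-other v∈x) (≤-reflexive (cong length eq)))
      reduce-at v (x ∷ y ∷ []) eq ((x≢y ∷ []) ∷ _)
        rewrite +-identityʳ (charge v y) = map₂ const (reduce-low (≤-reflexive (cong length eq))
          (star⁻ {S} (subst (x ∈ˡ_) (sym eq) (here refl)))
          (star⁻ {S} (subst (y ∈ˡ_) (sym eq) (there (here refl)))) x≢y)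
      reduce-at v (x ∷ y ∷ z ∷ []) eq ((x≢y ∷ x≢z ∷ []) ∷ (y≢z ∷ []) ∷ _)
        rewrite +-identityʳ (charge v z) = map₂ const (reduce-high
          (λ lv → <-irrefl (cong length eq) (s≤s lv))
          (star⁻ {S} (subst (x ∈ˡ_) (sym eq) (here refl)))
          (star⁻ {S} (subst (y ∈ˡ_) (sym eq) (there (here refl))))
          (star⁻ {S} (subst (z ∈ˡ_) (sym eq) (there (there (here refl))))) x≢y x≢z y≢z
          λ {g} atg → listed (subst (g ∈ˡ_) eq (star⁺ {S} atg)))
        where
        listed : ∀ {g} → g ∈ˡ x ∷ y ∷ z ∷ [] → g ≡ x ⊎ g ≡ y ⊎ g ≡ z
        listed (here refl)                 = inj₁ refl
        listed (there (here refl))         = inj₂ (inj₁ refl)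
        listed (there (there (here refl))) = inj₂ (inj₂ refl)
      reduce-at v (x ∷ y ∷ z ∷ t ∷ L) eq _ = contradiction (deg≤3 S v) λ d≤3 →
        <⇒≱ (s≤s (s≤s (s≤s (s≤s z≤n)))) (subst (λ M → length M ≤ 3) eq d≤3)

      -- If every vertex of `support` charged 12, double counting would contradict sparsity. So some
      -- vertex charges less, and its surroundings are reducible.
      reducible : 10 * ∣ S ∣ <ℕ 12 * ∣ support ∣ → ∃ (Good S)
      reducible sparse with any? (λ v → ¬? (1 ≤? deg S v →-dec 12 ≤? total v))
      ... | yes (v , ¬charged) = [ id , (λ charged → contradiction charged ¬charged) ]′
        (reduce-at v (star S v) refl (star-unique S v))
      ... | no all-charged = contradiction sparse (≤⇒≯ (begin
          12 * ∣ support ∣                                    ≡⟨ ∑-subset support 12 ⟨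
          ∑ (λ v → if does (v ∈? support) then 12 else 0)     ≤⟨ ∑-mono (λ v → if-dec (v ∈? support) (charged v ∘ ∈-support⁻)) ⟩
          ∑ total                                             ≤⟨ ∑-total ⟩
          10 * ∣ S ∣                                          ∎))
        where
        open ≤-Reasoning
        charged : ∀ v → 1 ≤ deg S v → 12 ≤ total v
        charged v = decidable-stable (1 ≤? deg S v →-dec 12 ≤? total v) (λ ¬charged → all-charged (v , ¬charged))
        if-dec : ∀ {A : Set} (a? : Dec A) {x y} → (A → x ≤ y) → (if does a? then x else 0) ≤ y
        if-dec (yes a) f = f a
        if-dec (no _)  _ = z≤n

  -- Induction on the number of edges, and return to the original definitions.

  good-coloring : (∀ vs es → Closed G vs es → NonZero ∣ vs ∣ → 10 * ∣ es ∣ <ℕ 12 * ∣ vs ∣) → ∀ S → ∃ (Good S)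
  good-coloring sparse S = go (suc ∣ S ∣) S ≤-refl
    where
    go : ∀ n S → ∣ S ∣ <ℕ n → ∃ (Good S)
    go (suc n) S (s≤s ∣S∣≤n) with nonempty? S
    ... | no empty = const one , record
        { matching = λ e∈S → contradiction (_ , e∈S) empty ; induced = λ e∈S → contradiction (_ , e∈S) empty }
      , λ w _ bad → let h , (h∈S , _) , _ = bad-edge {S} {const one} {w} bad in empty (h , h∈S)
    -- Sparsity is applied to `S` together with its non-isolated vertices, of which the ends of `e`
    -- are examples.
    ... | yes (e , e∈S) = reducible (λ T T<S → go n T (≤-trans T<S ∣S∣≤n))
        (sparse support S
          (λ f f∈S → ∈-support⁺ (f∈S , inj₁ refl) , ∈-support⁺ (f∈S , inj₂ refl))
          (>-nonZero (≤-<-trans z≤n (x∈p⇒∣p-x∣<∣p∣ (∈-support⁺ (e∈S , inj₁ refl))))))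
      where open Discharge S

  -- Walks of length 1 and 2 in the line graph are chains of one and two meetings. A vertex within
  -- distance one of `u` is `u` or the far end of an edge at `u`, so its edges lie in `near`.
  good⇒isGood : ∀ {c} → Good ⊤ c → IsGood G c
  good⇒isGood {c} (p , fair) = (one-far , two-far) , λ u d≡2 sees-one sees-twos →
      fair u (≤-trans (deg≤degree ⊤ u) (≤-reflexive d≡2))
        ( (let e , u∈e , ce = sees-one in lose (star⁺ {⊤} (∈⊤ , u∈e)) ce)
        , λ i → let f , cf , d = sees-twos i in
            lose ([ (λ d → close d (inj₁ refl)) , (λ d → close d (inj₂ refl)) ]′ d) cf)
    where
    one-far : ∀ e f → e ≢ f → c e ≡ one → c f ≡ one → Distance≥ LineAdjacent 2 e f
    one-far e f e≢f ce cf []                = contradiction refl e≢f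
    one-far e f e≢f ce cf ((_ , ef) ∷ [])   = contradiction (matching p ∈⊤ ∈⊤ ef ce cf) e≢f
    one-far e f e≢f ce cf (_ ∷ _ ∷ _)       = s≤s (s≤s z≤n)
    two-far : ∀ i e f → e ≢ f → c e ≡ two i → c f ≡ two i → Distance≥ LineAdjacent 3 e f
    two-far i e f e≢f ce cf []              = contradiction refl e≢f
    two-far i e f e≢f ce cf ((_ , ef) ∷ []) = contradiction (induced p ∈⊤ ∈⊤ ∈⊤ meets-refl ef ce cf) e≢f
    two-far i e f e≢f ce cf ((_ , eg) ∷ (_ , gf) ∷ []) = contradiction (induced p ∈⊤ ∈⊤ ∈⊤ eg gf ce cf) e≢f
    two-far i e f e≢f ce cf (_ ∷ _ ∷ _ ∷ _) = s≤s (s≤s (s≤s z≤n))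
    close : ∀ {u x f} → Distance≤ Adjacent 1 u x → Incident x f → f ∈ˡ near ⊤ u
    close (_ , _ , []) x∈f = star⊆near {⊤} (∈⊤ , x∈f)
    close (_ , _ , (h , j) ∷ []) x∈f = near⁺ {⊤} (∈⊤ , joinsˡ {h} j) ∈⊤ (_ , joinsʳ {h} j , x∈f)
    close (_ , s≤s () , _ ∷ _ ∷ _) x∈f

-- Passage from the maximum average degree to an inequality of integers.

12/5≤ : ∀ n d .{{_ : NonZero d}} → 12 * d ≤ n * 5 → (+ 12 / 5) ℚ.≤ (+ n / d)
-- As `_/_` reduces to lowest terms, the cross multiplication takes place among unnormalised
-- rationals.
12/5≤ n (suc m) le = ℚ.toℚᵘ-cancel-≤ (begin
  ℚ.toℚᵘ (+ 12 / 5)    ≃⟨ ℚ.toℚᵘ-fromℚᵘ (mkℚᵘ (+ 12) 4) ⟩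
  mkℚᵘ (+ 12) 4        ≤⟨ ℚᵘ.*≤* (subst₂ ℤ._≤_ (ℤ.pos-* 12 (suc m)) (ℤ.pos-* n 5) (ℤ.+≤+ le)) ⟩
  mkℚᵘ (+ n) m         ≃⟨ ℚ.toℚᵘ-fromℚᵘ (mkℚᵘ (+ n) m) ⟨
  ℚ.toℚᵘ (+ n / suc m) ∎)
  where open ℚᵘ.≤-Reasoning

theorem3p1 : (G : Graph) → Graph.Subcubic G → mad G < + 12 / 5 → ∃[ c ] IsGood G c
theorem3p1 G subcubic mad<12/5 = let c , good = good-coloring sparse ⊤ in c , good⇒isGood good
  where
  open Graph G
  degree≤3 : ∀ v → degree v ≤ 3
  degree≤3 v = ≤-trans (All.lookup (xs≤max 0 (tabulate degree)) (∈-tabulate⁺ v)) subcubic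
  open Reducibility G degree≤3
  sparse : ∀ vs es → Closed G vs es → NonZero ∣ vs ∣ → 10 * ∣ es ∣ <ℕ 12 * ∣ vs ∣
  -- Otherwise this subgraph would have average degree at least 12/5; the factor 10 is the 5 of the
  -- denominator times the 2 in the average degree.
  sparse vs es closed nz = ≰⇒> λ dense → ℚ.<-irrefl refl (ℚ.<-≤-trans mad<12/5 (ℚ.≤-trans
    (12/5≤ (2 * ∣ es ∣) ∣ vs ∣ {{nz}} (≤-trans dense (≤-reflexive (trans (*-assoc 5 2 ∣ es ∣) (*-comm 5 (2 * ∣ es ∣))))))
    (averageDegree≤mad G (subgraph vs es closed {{nz}}))))
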